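{- There exists a positive constant $c$ such that for all sufficiently large positive integers $r$, \[ G(r) > 2^{c (\log r)^{5/2}/\sqrt{\log \log r}}. \]
   Context: All logarithms are base 2. For positive integers $m,n$, the grid graph $\Gamma_{m,n}$ is the graph on vertex set $[m]\times[n]$ in which distinct vertices $(i,j),(i',j')$ are adjacent iff $i=i'$ or $j=j'$ (i.e. the Cartesian product $K_m\times K_n$). A rectangle is the induced subgraph on $\{(i,j),(i',j),(i,j'),(i',j')\}$ with $i<i'$, $j<j'$. In an edge coloring, a rectangle is alternating if the edges $\{(i,j),(i',j)\}$ and $\{(i,j'),(i',j')\}$ have the same color and the edges $\{(i,j),(i,j')\}$ and $\{(i',j),(i',j')\}$ have the same color. $G(r)$ is the minimum integer $n$ such that every edge coloring of $\Gamma_{n,n}$ with $r$ colors contains an alternating rectangle. -}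

module Defs where

open import Data.Nat as ℕ using (ℕ; zero; suc)
import Data.Nat.Properties as ℕ
open import Data.Integer as ℤ using (ℤ)
open import Data.Rational as ℚ using (ℚ; 0ℚ; 1ℚ; ½; ↥_; ↧ₙ_)
open import Data.Fin as Fin using (Fin; zero; suc; toℕ; combine; remQuot; finToFun; funToFin; inject≤)
import Data.Fin.Properties as Fin
open import Data.Product using (Σ; ∃; ∃-syntax; Σ-syntax; _×_; _,_; proj₁; proj₂; uncurry)
open import Data.Product.Properties using (≡-dec)
open import Data.Sum using (_⊎_; inj₁; inj₂)
open import Data.Empty using (⊥-elim)
open import Data.Empty.Irrelevant using () renaming (⊥-elim to ⊥-elim-irr)
open import Relation.Nullary using (¬_; Dec; yes; no; contradiction)
open import Relation.Nullary.Decidable using (¬?; _×-dec_; _⊎-dec_; map′)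
open import Relation.Unary using (Decidable)
open import Relation.Binary.PropositionalEquality
  using (_≡_; _≢_; refl; sym; trans; cong; cong₂; module ≡-Reasoning)
import Algebra.Definitions.RawSemiring ℚ.+-*-rawSemiring as ℚ^

------------------------------------------------------------------------
-- Grid graphs and their edge colorings

Vertex : ℕ → ℕ → Set
Vertex m n = Fin m × Fin n

Adj : ∀ {m n} → Vertex m n → Vertex m n → Set
Adj u v = u ≢ v × (proj₁ u ≡ proj₁ v ⊎ proj₂ u ≡ proj₂ v)

-- A coloring of unordered edges: a symmetric function on ordered pairs of
-- adjacent vertices that does not depend on the proof of adjacency.
record EdgeColoring (r m n : ℕ) : Set where
  field
    color     : (u v : Vertex m n) → .(Adj u v) → Fin r
    symmetric : ∀ u v .(e : Adj u v) .(e′ : Adj v u) → color u v e ≡ color v u e′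

open EdgeColoring public

sameCol : ∀ {m n} {i i′ : Fin m} (j : Fin n) → i Fin.< i′ → Adj (i , j) (i′ , j)
sameCol j i<i′ = (λ eq → Fin.<⇒≢ i<i′ (cong proj₁ eq)) , inj₂ refl

sameRow : ∀ {m n} (i : Fin m) {j j′ : Fin n} → j Fin.< j′ → Adj (i , j) (i , j′)
sameRow i j<j′ = (λ eq → Fin.<⇒≢ j<j′ (cong proj₂ eq)) , inj₁ refl

Alternating : ∀ {r m n} → EdgeColoring r m n →
              {i i′ : Fin m} {j j′ : Fin n} → i Fin.< i′ → j Fin.< j′ → Set
Alternating χ {i} {i′} {j} {j′} i<i′ j<j′ =
    color χ (i , j) (i′ , j) (sameCol j i<i′) ≡ color χ (i , j′) (i′ , j′) (sameCol j′ i<i′)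
  × color χ (i , j) (i , j′) (sameRow i j<j′) ≡ color χ (i′ , j) (i′ , j′) (sameRow i′ j<j′)

HasAlternatingRectangle : ∀ {r m n} → EdgeColoring r m n → Set
HasAlternatingRectangle {_} {m} {n} χ =
  Σ[ i ∈ Fin m ] Σ[ i′ ∈ Fin m ] Σ[ j ∈ Fin n ] Σ[ j′ ∈ Fin n ]
  Σ[ i<i′ ∈ i Fin.< i′ ] Σ[ j<j′ ∈ j Fin.< j′ ] Alternating χ i<i′ j<j′

Unavoidable : ℕ → ℕ → Set
Unavoidable r n = (χ : EdgeColoring r n n) → HasAlternatingRectangle χ

IsLeast : (ℕ → Set) → ℕ → Set
IsLeast P n = P n × (∀ m → P m → n ℕ.≤ m)

------------------------------------------------------------------------
-- Existence of G(r): Unavoidable r is decidable, and holds for some n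

private

  adj? : ∀ {m n} (u v : Vertex m n) → Dec (Adj u v)
  adj? u v = ¬? (≡-dec Fin._≟_ Fin._≟_ u v)
    ×-dec ((proj₁ u Fin.≟ proj₁ v) ⊎-dec (proj₂ u Fin.≟ proj₂ v))

  hasAlternatingRectangle? : ∀ {r m n} (χ : EdgeColoring r m n) →
                             Dec (HasAlternatingRectangle χ)
  hasAlternatingRectangle? χ =
    Fin.any? λ i → Fin.any? λ i′ → Fin.any? λ j → Fin.any? λ j′ → at i i′ j j′
    where
    at : ∀ i i′ j j′ → Dec (Σ[ i<i′ ∈ i Fin.< i′ ] Σ[ j<j′ ∈ j Fin.< j′ ] Alternating χ i<i′ j<j′)
    at i i′ j j′ with i Fin.<? i′ | j Fin.<? j′
    ... | no ¬p | _     = no λ (p , _) → ¬p p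
    ... | yes _ | no ¬q = no λ (_ , q , _) → ¬q q
    ... | yes p | yes q = map′ (λ a → p , q , a) (λ (_ , _ , a) → a)
      ((color χ (i , j) (i′ , j) (sameCol j p) Fin.≟ color χ (i , j′) (i′ , j′) (sameCol j′ p))
      ×-dec
      (color χ (i , j) (i , j′) (sameRow i q) Fin.≟ color χ (i′ , j) (i′ , j′) (sameRow i′ q)))

  _≗ᶜ_ : ∀ {r m n} → EdgeColoring r m n → EdgeColoring r m n → Set
  χ ≗ᶜ ψ = ∀ u v .(e : Adj u v) → color χ u v e ≡ color ψ u v e

  transfer : ∀ {r m n} (χ ψ : EdgeColoring r m n) → χ ≗ᶜ ψ →
             HasAlternatingRectangle χ → HasAlternatingRectangle ψ
  transfer χ ψ eq (i , i′ , j , j′ , p , q , a , b) =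
    i , i′ , j , j′ , p , q
    , trans (sym (eq _ _ (sameCol j p))) (trans a (eq _ _ (sameCol j′ p)))
    , trans (sym (eq _ _ (sameRow i q))) (trans b (eq _ _ (sameRow i′ q)))

  Table : ℕ → ℕ → ℕ → Set
  Table r m n = Fin (m ℕ.* n) → Fin (m ℕ.* n) → Fin r

  index : ∀ {m n} → Vertex m n → Fin (m ℕ.* n)
  index = uncurry combine

  sorted : ∀ {r k} → (Fin k → Fin k → Fin r) → Fin k → Fin k → Fin r
  sorted T i j with i Fin.≤? j
  ... | yes _ = T i j
  ... | no  _ = T j i

  sorted-sym : ∀ {r k} (T : Fin k → Fin k → Fin r) i j → sorted T i j ≡ sorted T j i
  sorted-sym T i j with i Fin.≤? j | j Fin.≤? i
  ... | yes p | yes q = cong₂ T (Fin.≤-antisym p q) (sym (Fin.≤-antisym p q))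
  ... | yes _ | no  _ = refl
  ... | no  _ | yes _ = refl
  ... | no ¬p | no ¬q = contradiction (ℕ.<⇒≤ (ℕ.≰⇒> ¬p)) ¬q

  fromTable : ∀ {r m n} → Table r m n → EdgeColoring r m n
  fromTable T = record
    { color     = λ u v _ → sorted T (index u) (index v)
    ; symmetric = λ u v _ _ → sorted-sym T (index u) (index v)
    }

  colorOr : ∀ {r m n} → Fin r → EdgeColoring r m n → Vertex m n → Vertex m n → Fin r
  colorOr d χ u v with adj? u v
  ... | yes e = color χ u v e
  ... | no  _ = d

  colorOr-adj : ∀ {r m n} d (χ : EdgeColoring r m n) u v .(e : Adj u v) →
                colorOr d χ u v ≡ color χ u v e
  colorOr-adj d χ u v e with adj? u v
  ... | yes _ = refl
  ... | no ¬e = ⊥-elim-irr (¬e e)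

  adj-sym : ∀ {m n} {u v : Vertex m n} → Adj u v → Adj v u
  adj-sym (u≢v , inj₁ p) = (λ eq → u≢v (sym eq)) , inj₁ (sym p)
  adj-sym (u≢v , inj₂ p) = (λ eq → u≢v (sym eq)) , inj₂ (sym p)

  toTable : ∀ {r m n} → Fin r → EdgeColoring r m n → Table r m n
  toTable {_} {m} {n} d χ i j = colorOr d χ (remQuot {m} n i) (remQuot {m} n j)

  toTable-index : ∀ {r m n} d (χ : EdgeColoring r m n) u v .(e : Adj u v) →
                  toTable d χ (index u) (index v) ≡ color χ u v e
  toTable-index d χ u v e = trans
    (cong₂ (colorOr d χ) (Fin.remQuot-combine (proj₁ u) (proj₂ u))
                         (Fin.remQuot-combine (proj₁ v) (proj₂ v)))
    (colorOr-adj d χ u v e)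

  fromTable-toTable : ∀ {r m n} d (χ : EdgeColoring r m n) (T : Table r m n) →
                      (∀ i j → T i j ≡ toTable d χ i j) → fromTable T ≗ᶜ χ
  fromTable-toTable d χ T eq u v e with index u Fin.≤? index v
  ... | yes _ = trans (eq _ _) (toTable-index d χ u v e)
  ... | no  _ = trans (eq _ _) (trans (toTable-index d χ v u (adj-sym e))
                                      (symmetric χ v u (adj-sym e) e))

  someColor : ∀ {r n} → EdgeColoring r (2 ℕ.+ n) (2 ℕ.+ n) → Fin r
  someColor χ = color χ (zero , zero) (zero , suc zero) ((λ ()) , inj₁ refl)

  decode : ∀ {r k} → Fin ((r ℕ.^ k) ℕ.^ k) → Fin k → Fin k → Fin r
  decode t i = finToFun (finToFun t i)

  encode : ∀ {r k} → (Fin k → Fin k → Fin r) → Fin ((r ℕ.^ k) ℕ.^ k)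
  encode T = funToFin (λ i → funToFin (T i))

  decode-encode : ∀ {r k} (T : Fin k → Fin k → Fin r) i j → decode (encode T) i j ≡ T i j
  decode-encode T i j = trans
    (cong (λ t → finToFun t j) (Fin.finToFun-funToFin (λ i → funToFin (T i)) i))
    (Fin.finToFun-funToFin (T i) j)

  unavoidable? : ∀ r → Decidable (Unavoidable r)
  unavoidable? r 0 = no λ f → case₀ (f χ₀)
    where
    χ₀ : EdgeColoring r 0 0
    χ₀ = record { color = λ { (() , _) } ; symmetric = λ { (() , _) } }
    case₀ : ¬ HasAlternatingRectangle χ₀
    case₀ (() , _)
  unavoidable? r 1 = no λ f → case₁ (f χ₁)
    where
    noEdge : ∀ {u v : Vertex 1 1} → ¬ Adj u v
    noEdge {zero , zero} {zero , zero} (u≢v , _) = u≢v refl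
    χ₁ : EdgeColoring r 1 1
    χ₁ = record { color     = λ _ _ e → ⊥-elim-irr (noEdge e)
                ; symmetric = λ _ _ e _ → ⊥-elim-irr (noEdge e) }
    case₁ : ¬ HasAlternatingRectangle χ₁
    case₁ (zero , zero , _ , _ , () , _)
  unavoidable? r (suc (suc n)) = map′
    (λ all χ → let d = someColor χ ; t = encode (toTable d χ) in
       transfer (fromTable (decode t)) χ
         (fromTable-toTable d χ (decode t) (decode-encode (toTable d χ))) (all t))
    (λ f t → f (fromTable (decode t)))
    (Fin.all? λ t → hasAlternatingRectangle? (fromTable (decode t)))

  -- Among more than r^((r+1)²) columns two carry the same coloring on the
  -- first r + 1 rows; two of the r + 1 edges joining them agree in color.
  unavoidable-bound : ∀ r → ∃[ n ] Unavoidable r n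
  unavoidable-bound r = N , λ χ →
    let d = someColor χ
        col = λ (j : Fin N) (a b : Fin k) → colorOr d χ (row a , j) (row b , j)
        j , j′ , j<j′ , same = Fin.pigeonhole columns (λ j → encode (col j))
        a , a′ , a<a′ , same′ = Fin.pigeonhole (ℕ.n<1+n r)
          (λ a → color χ (row a , j) (row a , j′) (sameRow (row a) j<j′))
        p = row-mono a<a′
    in row a , row a′ , j , j′ , p , j<j′
       , (begin
            color χ (row a , j) (row a′ , j) (sameCol j p)
              ≡⟨ colorOr-adj d χ _ _ (sameCol j p) ⟨
            col j a a′
              ≡⟨ decode-encode (col j) a a′ ⟨
            decode (encode (col j)) a a′
              ≡⟨ cong (λ t → decode t a a′) same ⟩
            decode (encode (col j′)) a a′
              ≡⟨ decode-encode (col j′) a a′ ⟩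
            col j′ a a′
              ≡⟨ colorOr-adj d χ _ _ (sameCol j′ p) ⟩
            color χ (row a , j′) (row a′ , j′) (sameCol j′ p) ∎)
       , same′
    where
    open ≡-Reasoning
    k M N : ℕ
    k = suc r
    M = (r ℕ.^ k) ℕ.^ k
    N = 2 ℕ.+ (k ℕ.+ M)
    k≤N : k ℕ.≤ N
    k≤N = ℕ.≤-trans (ℕ.m≤m+n k M) (ℕ.m≤n+m (k ℕ.+ M) 2)
    columns : M ℕ.< N
    columns = ℕ.s≤s (ℕ.≤-trans (ℕ.m≤n+m M k) (ℕ.n≤1+n _))
    row : Fin k → Fin N
    row a = inject≤ a k≤N
    row-mono : ∀ {a b} → a Fin.< b → row a Fin.< row b
    row-mono {a} {b} a<b
      rewrite Fin.toℕ-inject≤ a k≤N | Fin.toℕ-inject≤ b k≤N = a<b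

  search : ∀ {P : ℕ → Set} → Decidable P → ∀ n →
           (∃[ m ] IsLeast P m) ⊎ (∀ m → P m → n ℕ.≤ m)
  search P? zero = inj₂ λ _ _ → ℕ.z≤n
  search P? (suc n) with search P? n
  ... | inj₁ found = inj₁ found
  ... | inj₂ n≤ with P? n
  ...   | yes Pn = inj₁ (n , Pn , n≤)
  ...   | no ¬Pn = inj₂ λ m Pm → ℕ.≤∧≢⇒< (n≤ m Pm) λ { refl → ¬Pn Pm }

  least : ∀ {P : ℕ → Set} → Decidable P → ∃ P → ∃[ m ] IsLeast P m
  least P? (n , Pn) with search P? (suc n)
  ... | inj₁ found = found
  ... | inj₂ n<    = contradiction (n< n Pn) (ℕ.<-irrefl refl)

G : ℕ → ℕ
G r = proj₁ (least (unavoidable? r) (unavoidable-bound r))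

G-isLeast : ∀ r → IsLeast (Unavoidable r) (G r)
G-isLeast r = proj₂ (least (unavoidable? r) (unavoidable-bound r))

------------------------------------------------------------------------
-- Real numbers as two-sided Dedekind cuts of ℚ

-- lower x q means q < x, and upper x q means x < q.
record Cut : Set₁ where
  field
    lower upper : ℚ → Set

open Cut public

record IsReal (x : Cut) : Set where
  field
    lower-inhabited : ∃[ q ] lower x q
    upper-inhabited : ∃[ q ] upper x q
    lower-closed    : ∀ {p q} → p ℚ.< q → lower x q → lower x p
    upper-closed    : ∀ {p q} → p ℚ.< q → upper x p → upper x q
    lower-open      : ∀ {p} → lower x p → ∃[ q ] (p ℚ.< q × lower x q)
    upper-open      : ∀ {q} → upper x q → ∃[ p ] (p ℚ.< q × upper x p)
    disjoint        : ∀ {q} → ¬ (lower x q × upper x q)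
    located         : ∀ {p q} → p ℚ.< q → lower x p ⊎ upper x q

infix 4 _<ᴿ_
_<ᴿ_ : Cut → Cut → Set
x <ᴿ y = ∃[ q ] (upper x q × lower y q)

fromℚ : ℚ → Cut
fromℚ p = record { lower = λ q → q ℚ.< p ; upper = λ q → p ℚ.< q }

fromℕ : ℕ → Cut
fromℕ n = fromℚ (ℤ.+ n ℚ./ 1)

infixl 7 _*ᴿ_ _÷ᴿ_
infixr 8 _^ᴿ_

-- For a < x < b and c < y < d, the product xy lies strictly between the
-- least and the greatest of ac, ad, bc, bd.
_*ᴿ_ : Cut → Cut → Cut
x *ᴿ y = record
  { lower = λ q → ∃[ a ] ∃[ b ] ∃[ c ] ∃[ d ]
      ( lower x a × upper x b × lower y c × upper y d
      × q ℚ.< a ℚ.* c × q ℚ.< a ℚ.* d × q ℚ.< b ℚ.* c × q ℚ.< b ℚ.* d )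
  ; upper = λ q → ∃[ a ] ∃[ b ] ∃[ c ] ∃[ d ]
      ( lower x a × upper x b × lower y c × upper y d
      × a ℚ.* c ℚ.< q × a ℚ.* d ℚ.< q × b ℚ.* c ℚ.< q × b ℚ.* d ℚ.< q )
  }

_^ᴿ_ : Cut → ℕ → Cut
x ^ᴿ zero  = fromℚ 1ℚ
x ^ᴿ suc n = x *ᴿ x ^ᴿ n

-- The reciprocal; correct only for x > 0.
recip : Cut → Cut
recip x = record
  { lower = λ q → ∃[ b ] (upper x b × q ℚ.* b ℚ.< 1ℚ)
  ; upper = λ q → ∃[ a ] (0ℚ ℚ.< a × lower x a × 1ℚ ℚ.< q ℚ.* a)
  }

-- Division; correct only for y > 0.
_÷ᴿ_ : Cut → Cut → Cut
x ÷ᴿ y = x *ᴿ recip y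

-- The square root; correct only for x ≥ 0.
√_ : Cut → Cut
√ x = record
  { lower = λ q → q ℚ.< 0ℚ ⊎ lower x (q ℚ.* q)
  ; upper = λ q → 0ℚ ℚ.< q × upper x (q ℚ.* q)
  }

2^ℤ_ : ℤ → ℚ
2^ℤ (ℤ.+ n)    = (1ℚ ℚ.+ 1ℚ) ℚ^.^ n
2^ℤ ℤ.-[1+ n ] = ½ ℚ^.^ suc n

-- The logarithm to base 2; correct only for x > 0.  For q = a / b in lowest
-- terms, b ≥ 1, q < log₂ x iff 2ᵃ < xᵇ.
log₂ : Cut → Cut
log₂ x = record
  { lower = λ q → lower (x ^ᴿ (↧ₙ q)) (2^ℤ (↥ q))
  ; upper = λ q → upper (x ^ᴿ (↧ₙ q)) (2^ℤ (↥ q))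
  }

-- 2 to the power x.  For rational s = a / b in lowest terms, b ≥ 1, and q > 0,
-- q < 2ˢ iff qᵇ < 2ᵃ.
exp₂ : Cut → Cut
exp₂ x = record
  { lower = λ q → q ℚ.≤ 0ℚ ⊎ ∃[ s ] (lower x s × q ℚ^.^ (↧ₙ s) ℚ.< 2^ℤ (↥ s))
  ; upper = λ q → 0ℚ ℚ.< q × ∃[ s ] (upper x s × 2^ℤ (↥ s) ℚ.< q ℚ^.^ (↧ₙ s))
  }

-- x to the power 5/2; correct only for x ≥ 0.
_^5/2 : Cut → Cut
x ^5/2 = √ (x ^ᴿ 5)

{-# OPTIONS --safe #-}

-- Colour the edge between columns j and j′ in row i by word i (base j j′), where
-- base is a fixed colouring of the pairs of columns with D classes and the rows
-- have words of length D over r symbols, any two agreeing in at most p places.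
-- There is no alternating rectangle if the edges between rows i and i′ properly
-- colour the graph of pairs of columns on which the two rows agree, which is a
-- union of at most p classes.  So the base colouring must be such that every
-- union of p classes has chromatic number at most r.
--
-- Columns are K blocks of d symbols.  The class of a pair of columns records a
-- block in which they differ, the set δ of all positions of that block where they
-- differ, the last position a of δ, and the symbol x of the first column at a.
-- To colour a union of classes, ask of a column whether its symbol at a is x.
-- If yes for both ends of an edge, its class has a ∉ δ; if no for both, it is not
-- the class that supplied the query.  As long as some position a lies in more
-- than t of the sets δ, this yields few colours; afterwards the classes are
-- t-degenerate, and the parities of the answers over t independent groups per
-- block suffice.  In total p = m t classes need at most (1 + t)^m 2^(K t) colours.
-- With log r ~ s² k² and log log r ~ s² one takes K = k, t = s² k, m = k² and gets
-- s⁴ k⁵ ~ (log r)^(5/2) / √(log log r) for the logarithm of the size of the grid.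
module Submission where

open import Defs
open import Data.Nat using
  (ℕ; zero; suc; pred; _+_; _*_; _^_; _≤_; _<_; z≤n; s≤s; s≤s⁻¹; NonZero; >-nonZero; >-nonZero⁻¹)
import Data.Nat.Properties as ℕ
open import Data.Nat.Coprimality using (1-coprimeTo) renaming (sym to coprime-sym)
open import Data.Nat.Tactic.RingSolver using (solve-∀)
open import Data.Integer as ℤ using (ℤ)
import Data.Integer.Properties as ℤ
open import Data.Rational as ℚ using (ℚ; mkℚ; 0ℚ; 1ℚ; ½)
import Data.Rational.Properties as ℚ
open import Data.Rational.Solver using (module +-*-Solver)
open import Data.Bool using (Bool; true; false; _∧_; _xor_; if_then_else_)
import Data.Bool.Properties as Bool
open import Data.Fin as Fin using (Fin; zero; suc; finToFun; funToFin; combine; remQuot; inject≤)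
import Data.Fin.Properties as Fin
open import Data.List using (List; []; _∷_; length; filter; map; lookup; tabulate; allFin)
open import Data.List.Properties using (filter-accept; filter-notAll; length-map)
open import Data.List.Relation.Unary.All as All using (All; []; _∷_)
import Data.List.Relation.Unary.All.Properties as All
open import Data.List.Relation.Unary.Any as Any using (Any; here; there)
import Data.List.Relation.Unary.Any.Properties as Any
open import Data.List.Relation.Unary.AllPairs using (AllPairs; []; _∷_)
import Data.List.Relation.Unary.AllPairs.Properties as AllPairs
open import Data.List.Membership.Propositional using (_∈_; _∉_; find)
open import Data.List.Membership.Propositional.Properties using (∈-filter⁺; ∈-map⁺; ∈-allFin)
open import Data.Product using (∃-syntax; _×_; _,_; proj₁; proj₂)
open import Data.Sum using (_⊎_; inj₁; inj₂)
open import Data.Sum.Properties using (inj₁-injective; inj₂-injective)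
open import Data.Empty.Irrelevant using () renaming (⊥-elim to ⊥-elim-irr)
open import Function using (_∘_; id)
open import Relation.Nullary using (¬_; Dec; yes; no; does; contradiction)
open import Relation.Nullary.Decidable using (¬?; _×-dec_; _⊎-dec_; dec-true; dec-false; decidable-stable; from-yes)
open import Relation.Unary using (Pred; Decidable)
open import Relation.Unary.Properties using (∁?)
open import Relation.Binary using (Tri; tri<; tri≈; tri>)
open import Relation.Binary.PropositionalEquality
open import Algebra.Properties.Semiring.Sum ℕ.+-*-semiring
  using (sum; sum-syntax; sum-cong-≗; ∑-comm; *-distribˡ-sum)

-- Colouring unions of bipartite graphs

module _ {a p} {A : Set a} {P : Pred A p} (P? : Decidable P) where

  length-filter-∷ : ∀ x xs → length (filter P? xs) ≤ length (filter P? (x ∷ xs))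
  length-filter-∷ x xs with does (P? x)
  ... | true  = ℕ.n≤1+n _
  ... | false = ℕ.≤-refl

  length-filter-∁ : ∀ xs → length (filter P? xs) + length (filter (∁? P?) xs) ≡ length xs
  length-filter-∁ [] = refl
  length-filter-∁ (x ∷ xs) with ih ← length-filter-∁ xs | does (P? x)
  ... | true  = cong suc ih
  ... | false = trans (ℕ.+-suc _ _) (cong suc ih)

length-filter-map : ∀ {a b p} {A : Set a} {B : Set b} {P : Pred B p} (P? : Decidable P)
                    (f : A → B) xs →
                    length (filter (P? ∘ f) xs) ≡ length (filter P? (map f xs))
length-filter-map P? f [] = refl
length-filter-map P? f (x ∷ xs) with does (P? (f x))
... | true  = cong suc (length-filter-map P? f xs)
... | false = length-filter-map P? f xs

-- If every label occurred in `xs`, its position there would inject `Fin t` into the positions of a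
-- shorter list.
fresh-label : ∀ {t} (xs : List (Fin t)) → length xs < t → ∃[ ℓ ] ℓ ∉ xs
fresh-label {t} xs short with Fin.any? (λ ℓ → ¬? (Any.any? (ℓ Fin.≟_) xs))
... | yes found = found
... | no  none  = contradiction (Fin.injective⇒≤ index-injective) (ℕ.<⇒≱ short)
  where
  member : ∀ ℓ → ℓ ∈ xs
  member ℓ with Any.any? (ℓ Fin.≟_) xs
  ... | yes ℓ∈xs = ℓ∈xs
  ... | no  ℓ∉xs = contradiction (ℓ , ℓ∉xs) none
  index-injective : ∀ {i j} → Any.index (member i) ≡ Any.index (member j) → i ≡ j
  index-injective {i} {j} eq = trans (Any.lookup-index (member i))
    (trans (cong (lookup xs) eq) (sym (Any.lookup-index (member j))))

xor-cancelˡ : ∀ x {y z} → x xor y ≡ x xor z → y ≡ z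
xor-cancelˡ true  = Bool.not-injective
xor-cancelˡ false = λ eq → eq

-- A family of D bipartite graphs on V, grouped into K blocks.  The two ends of
-- an edge of graph c are told apart by test c.  Hit c c′ says that test c can
-- be true on at most one end of each edge of graph c′, while within a block
-- the absence of a hit makes test c constant along each edge of graph c′.
record Family (V : Set) (D K : ℕ) : Set₁ where
  field
    Edge      : Fin D → V → V → Set
    block     : Fin D → Fin K
    test      : Fin D → V → Bool
    Hit       : Fin D → Fin D → Set
    hit?      : ∀ c → Decidable (Hit c)
    hit-refl  : ∀ c → Hit c c
    edge-head : ∀ {c v w} → Edge c v w → test c v ≡ true
    edge-tail : ∀ {c v w} → Edge c v w → test c w ≡ false
    hit       : ∀ {c c′ v w} → Hit c c′ → Edge c′ v w →
                ¬ (test c v ≡ true × test c w ≡ true)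
    no-hit    : ∀ {c c′ v w} → block c ≡ block c′ → ¬ Hit c c′ → Edge c′ v w →
                test c v ≡ test c w

module Coloring {V : Set} {D K : ℕ} (𝓕 : Family V D K) where

  open Family 𝓕

  Proper : ∀ {A : Set} → (V → A) → Fin D → Set
  Proper f c = ∀ v w → Edge c v w → f v ≢ f w

  Colorable : ℕ → List (Fin D) → Set
  Colorable N cs = ∃[ f ] All (Proper {Fin N} f) cs

  weaken : ∀ {N N′ cs} → N ≤ N′ → Colorable N cs → Colorable N′ cs
  weaken N≤N′ (f , proper) = (λ v → Fin.inject≤ (f v) N≤N′) ,
    All.map (λ p v w e eq → p v w e (Fin.inject≤-injective N≤N′ N≤N′ _ _ eq)) proper

  degree : Fin D → List (Fin D) → ℕ
  degree c cs = length (filter (hit? c) cs)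

  -- Meant for `c` listed before `c′`: a conflict in either direction is then seen by the earlier
  -- graph, so its degree accounts for all conflicts with later ones.
  Ordered : Fin D → Fin D → Set
  Ordered c c′ = Hit c′ c → Hit c c′

  -- The value of `test c` selects one of two disjoint palettes. An edge with both ends true belongs
  -- to a graph not hit by `c`; one with both ends false belongs to a graph other than `c`, whose
  -- heads pass the test.
  branch : ∀ {N₁ N₂} c cs →
           Colorable N₁ (filter (∁? (hit? c)) cs) →
           Colorable N₂ (filter (¬? ∘ (Fin._≟ c)) cs) →
           Colorable (N₁ + N₂) cs
  branch {N₁} {N₂} c cs (f₁ , proper₁) (f₂ , proper₂) =
    Fin.join N₁ N₂ ∘ f , All.tabulate proper
    where
    f : V → Fin N₁ ⊎ Fin N₂
    f v = if test c v then inj₁ (f₁ v) else inj₂ (f₂ v)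
    join-injective : ∀ x y → Fin.join N₁ N₂ x ≡ Fin.join N₁ N₂ y → x ≡ y
    join-injective x y eq = trans (sym (Fin.splitAt-join N₁ N₂ x))
      (trans (cong (Fin.splitAt N₁) eq) (Fin.splitAt-join N₁ N₂ y))
    proper′ : ∀ {c′} → c′ ∈ cs → Proper f c′
    proper′ {c′} c′∈cs v w e eq with test c v in tv | test c w in tw
    ... | true | true with hit? c c′
    ...   | yes h = hit h e (tv , tw)
    ...   | no ¬h =
      All.lookup proper₁ (∈-filter⁺ (∁? (hit? c)) c′∈cs ¬h) v w e (inj₁-injective eq)
    proper′ {c′} c′∈cs v w e eq | false | false with c′ Fin.≟ c
    ...   | yes refl = contradiction (trans (sym tv) (edge-head e)) λ ()
    ...   | no c′≢c =
      All.lookup proper₂ (∈-filter⁺ (¬? ∘ (Fin._≟ c)) c′∈cs c′≢c) v w e (inj₂-injective eq)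
    proper : ∀ {c′} → c′ ∈ cs → Proper (Fin.join N₁ N₂ ∘ f) c′
    proper c′∈cs v w e eq = proper′ c′∈cs v w e (join-injective (f v) (f w) eq)

  -- Colouring the t-degenerate case by parities

  module Leaf {t : ℕ} where

    Independent : Fin D × Fin t → Fin D × Fin t → Set
    Independent (c , ℓ) (c′ , ℓ′) =
      block c ≡ block c′ → ℓ ≡ ℓ′ → ¬ Hit c c′ × ¬ Hit c′ c

    -- In the given order, every graph conflicts with at most t - 1 later ones.
    labelling : ∀ cs → AllPairs Ordered cs → All (λ c → degree c cs ≤ t) cs →
                ∃[ ls ] map proj₁ ls ≡ cs × AllPairs Independent ls
    labelling [] _ _ = [] , refl , []
    labelling (c ∷ cs) (ordered ∷ orders) (small ∷ smalls)
      with ls , refl , independent ← labelling cs orders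
        (All.map (λ {c′} → ℕ.≤-trans (length-filter-∷ (hit? c′) c cs)) smalls)
      = (c , ℓ) ∷ ls , refl , All.tabulate new ∷ independent
      where
      hits? : ∀ (l : Fin D × Fin t) → Dec (Hit c (proj₁ l))
      hits? l = hit? c (proj₁ l)
      used : List (Fin t)
      used = map proj₂ (filter hits? ls)
      few : length used < t
      few = begin-strict
        length used                          ≡⟨ length-map proj₂ (filter hits? ls) ⟩
        length (filter hits? ls)  ≡⟨ length-filter-map (hit? c) proj₁ ls ⟩
        degree c cs                          <⟨ ℕ.n<1+n _ ⟩
        -- As `c` hits itself, it uses up one of the `t` hits allowed, so that a label remains free.
        suc (degree c cs)                    ≡⟨ cong length (filter-accept (hit? c) (hit-refl c)) ⟨
        degree c (c ∷ cs)                    ≤⟨ small ⟩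
        t                                    ∎
        where open ℕ.≤-Reasoning
      ℓ : Fin t
      ℓ = proj₁ (fresh-label used few)
      new : ∀ {l} → l ∈ ls → Independent (c , ℓ) l
      new {c′ , _} l∈ls _ refl = miss , miss ∘ All.lookup ordered (∈-map⁺ proj₁ l∈ls)
        where
        miss : ¬ Hit c c′
        miss h = proj₂ (fresh-label used few)
          (∈-map⁺ proj₂ (∈-filter⁺ hits? l∈ls h))

    contribution : Fin D × Fin t → V → Fin K → Fin t → Bool
    contribution (c , ℓ′) v B ℓ = does (block c Fin.≟ B) ∧ does (ℓ′ Fin.≟ ℓ) ∧ test c v

    parity : List (Fin D × Fin t) → V → Fin K → Fin t → Bool
    parity []       v B ℓ = false
    parity (l ∷ ls) v B ℓ = contribution l v B ℓ xor parity ls v B ℓ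

    contribution-constant : ∀ {c ℓ l v w} → Edge c v w →
      (block c ≡ block (proj₁ l) → ℓ ≡ proj₂ l → ¬ Hit (proj₁ l) c) →
      contribution l v (block c) ℓ ≡ contribution l w (block c) ℓ
    contribution-constant {c} {ℓ} {c′ , ℓ′} e miss with block c′ Fin.≟ block c | ℓ′ Fin.≟ ℓ
    ... | yes B≡ | yes ℓ≡ = no-hit B≡ (miss (sym B≡) (sym ℓ≡)) e
    ... | yes _  | no _   = refl
    ... | no _   | _      = refl

    contribution-own : ∀ c ℓ v → contribution (c , ℓ) v (block c) ℓ ≡ test c v
    contribution-own c ℓ v
      rewrite dec-true (block c Fin.≟ block c) refl | dec-true (ℓ Fin.≟ ℓ) refl = refl

    parity-constant : ∀ {c ℓ v w} ls → Edge c v w → All (Independent (c , ℓ)) ls →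
      parity ls v (block c) ℓ ≡ parity ls w (block c) ℓ
    parity-constant []       e []                  = refl
    parity-constant (l ∷ ls) e (independent ∷ ind) = cong₂ _xor_
      (contribution-constant e (λ B≡ ℓ≡ → proj₂ (independent B≡ ℓ≡)))
      (parity-constant ls e ind)

    -- Along an edge of a listed graph its own test flips, while no other graph with the same block
    -- and label hits it, so their tests are constant. Exactly one term of the parity changes.
    parity-separates : ∀ {c ℓ v w ls} → AllPairs Independent ls → (c , ℓ) ∈ ls → Edge c v w →
      parity ls v (block c) ℓ ≢ parity ls w (block c) ℓ
    parity-separates {c} {ℓ} {v} {w} {_ ∷ ls} (ind ∷ _) (here refl) e eq
      rewrite contribution-own c ℓ v | contribution-own c ℓ w | edge-head e | edge-tail e
      = Bool.not-¬ (sym (parity-constant ls e ind)) (sym eq)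
    parity-separates {c} {ℓ} {v} {w} {l ∷ ls} (ind ∷ inds) (there ∈ls) e eq =
      parity-separates inds ∈ls e (xor-cancelˡ (contribution l v (block c) ℓ)
        (trans eq (cong (_xor parity ls w (block c) ℓ) (sym same))))
      where
      same : contribution l v (block c) ℓ ≡ contribution l w (block c) ℓ
      same = contribution-constant e
        λ B≡ ℓ≡ → proj₁ (All.lookup ind ∈ls (sym B≡) (sym ℓ≡))

    encode : (Fin K → Fin t → Bool) → Fin ((2 ^ t) ^ K)
    encode b = funToFin λ B → funToFin λ ℓ → if b B ℓ then suc zero else zero

    encode-injective : ∀ {b b′} → encode b ≡ encode b′ → ∀ B ℓ → b B ℓ ≡ b′ B ℓ
    encode-injective {b} {b′} eq B ℓ = bit-injective (b B ℓ) (b′ B ℓ)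
      (trans (sym (decode b)) (trans (cong (λ n → finToFun (finToFun n B) ℓ) eq) (decode b′)))
      where
      bit : Bool → Fin 2
      bit x = if x then suc zero else zero
      bit-injective : ∀ x y → bit x ≡ bit y → x ≡ y
      bit-injective true  true  _ = refl
      bit-injective false false _ = refl
      decode : ∀ b → finToFun (finToFun (encode b) B) ℓ ≡ bit (b B ℓ)
      decode b = trans
        (cong (λ n → finToFun n ℓ) (Fin.finToFun-funToFin (λ B → funToFin (bit ∘ b B)) B))
        (Fin.finToFun-funToFin (bit ∘ b B) ℓ)

    leaf : ∀ {cs} → AllPairs Ordered cs → All (λ c → degree c cs ≤ t) cs →
           Colorable ((2 ^ t) ^ K) cs
    leaf orders smalls with ls , refl , ind ← labelling _ orders smalls =
      (λ v → encode (parity ls v)) ,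
      All.map⁺ (All.tabulate λ { {c , ℓ} ∈ls v w e eq →
        parity-separates ind ∈ls e (encode-injective eq (block c) ℓ) })

  -- One query test c with degree c cs > t either destroys more than t graphs
  -- (those hit by c) or only c itself, so the number of colours satisfies
  -- X(q) ≤ X(q - 1) + X(q - t - 1).
  module _ (t : ℕ) where

    private
      M : ℕ
      M = (2 ^ t) ^ K

    open Leaf {t} using (leaf)

    colorable-step : ∀ {a X} → M ≤ X →
      (∀ cs → AllPairs Ordered cs → length cs ≤ a → Colorable X cs) →
      ∀ i cs → i ≤ t → AllPairs Ordered cs → length cs ≤ i + a → Colorable (suc i * X) cs
    colorable-step {X = X} M≤X base zero cs _ orders short =
      weaken (ℕ.≤-reflexive (sym (ℕ.*-identityˡ X))) (base cs orders short)
    colorable-step {a} {X} M≤X base (suc i) cs i<t orders short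
      with All.all? (λ c → degree c cs ℕ.≤? t) cs
    ... | yes smalls = weaken (ℕ.≤-trans M≤X (ℕ.m≤m+n X _)) (leaf orders smalls)
    ... | no  ¬smalls
      with c , c∈cs , large ← find (All.¬All⇒Any¬ (λ c → degree c cs ℕ.≤? t) cs ¬smalls) =
      branch c cs
        (base _ (AllPairs.filter⁺ (∁? (hit? c)) orders) short₁)
        (colorable-step M≤X base i _ (ℕ.<⇒≤ i<t)
          (AllPairs.filter⁺ (¬? ∘ (Fin._≟ c)) orders) short₂)
      where
      open ℕ.≤-Reasoning
      -- The true side loses more than `t` graphs, hence at least `suc i`, and falls under `base`;
      -- the false side loses at least `c` itself and falls under the induction on `i`. The colours
      -- add up to `X + suc i * X`.
      short₁ : length (filter (∁? (hit? c)) cs) ≤ a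
      short₁ = ℕ.+-cancelˡ-≤ (suc i) _ _ (begin
        suc i + length (filter (∁? (hit? c)) cs)
          ≤⟨ ℕ.+-monoˡ-≤ _ (ℕ.≤-trans i<t (ℕ.<⇒≤ (ℕ.≰⇒> large))) ⟩
        degree c cs + length (filter (∁? (hit? c)) cs) ≡⟨ length-filter-∁ (hit? c) cs ⟩
        length cs                                      ≤⟨ short ⟩
        suc i + a                                      ∎)
      short₂ : length (filter (¬? ∘ (Fin._≟ c)) cs) ≤ i + a
      short₂ = s≤s⁻¹ (begin
        suc (length (filter (¬? ∘ (Fin._≟ c)) cs))
          ≤⟨ filter-notAll (¬? ∘ (Fin._≟ c)) cs (Any.map (λ c≡ c′≢ → c′≢ (sym c≡)) c∈cs) ⟩
        length cs                                  ≤⟨ short ⟩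
        suc i + a                                  ∎)

    -- Raising the bound on the number of graphs by `t` costs a factor `suc t`, by `colorable-step`
    -- with `i = t`.
    colorable : ∀ k cs → AllPairs Ordered cs → length cs ≤ k * t → Colorable (suc t ^ k * M) cs
    colorable zero    []       orders _     = weaken (ℕ.m≤m+n M 0) (leaf orders [])
    colorable (suc k) cs       orders short =
      weaken (ℕ.≤-reflexive (sym (ℕ.*-assoc (suc t) (suc t ^ k) M)))
        (colorable-step (ℕ.m≤n*m M (suc t ^ k) {{ℕ.m^n≢0 (suc t) k}}) (colorable k)
          t cs ℕ.≤-refl orders short)

-- The base colouring of pairs of columns

funToFin-cong : ∀ {m n} {f g : Fin m → Fin n} → (∀ i → f i ≡ g i) → funToFin f ≡ funToFin g
funToFin-cong {zero}  f≗g = refl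
funToFin-cong {suc m} f≗g = cong₂ combine (f≗g zero) (funToFin-cong (f≗g ∘ suc))

finToFun-differ : ∀ {m n} {j j′ : Fin (n ^ m)} → j ≢ j′ → ∃[ i ] finToFun {n} {m} j i ≢ finToFun j′ i
finToFun-differ {m} {n} {j} {j′} j≢j′ = Fin.¬∀⟶∃¬ m _ (λ i → finToFun {n} {m} j i Fin.≟ finToFun j′ i)
  λ same → j≢j′ (trans (sym (Fin.funToFin-finToFin {m} j))
                (trans (funToFin-cong same) (Fin.funToFin-finToFin {m} j′)))

-- The tail is searched first, so `zero` is the answer only when all later values coincide.
last-difference : ∀ {d n} (f g : Fin d → Fin n) {a} → f a ≢ g a →
  ∃[ b ] f b ≢ g b × (∀ {b′} → b Fin.< b′ → f b′ ≡ g b′)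
last-difference {suc d} f g {a} fa≢ga with Fin.any? (λ i → ¬? (f (suc i) Fin.≟ g (suc i)))
... | yes (i , ≢) with b , fb≢gb , above ← last-difference (f ∘ suc) (g ∘ suc) ≢ =
  suc b , fb≢gb , λ { {suc b′} lt → above (s≤s⁻¹ lt) }
... | no none = zero , at a fa≢ga , λ { {suc b′} _ → same b′ }
  where
  same : ∀ i → f (suc i) ≡ g (suc i)
  same i = decidable-stable (f (suc i) Fin.≟ g (suc i)) λ ≢ → none (i , ≢)
  at : ∀ a → f a ≢ g a → f zero ≢ g zero
  at zero    ≢ = ≢
  at (suc i) ≢ = contradiction (same i) ≢

zero⊎one : (i : Fin 2) → i ≡ zero ⊎ i ≡ suc zero
zero⊎one zero       = inj₁ refl
zero⊎one (suc zero) = inj₂ refl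

module Blocks (K d β : ℕ) where

  Word : Set
  Word = Fin K → Fin d → Fin β

  -- The position is the leading digit, so that the numerical order of the classes sorts them by
  -- position; `ordered` relies on this.
  #classes : ℕ
  #classes = d * (K * (2 ^ d * β))

  Class : Set
  Class = Fin #classes

  record Fields : Set where
    constructor fields
    field
      position   : Fin d
      block      : Fin K
      difference : Fin (2 ^ d)
      symbol     : Fin β

    differs : Fin d → Fin 2
    differs = finToFun difference

  open Fields public

  private
    unpack₃ : Fin d → Fin K → Fin (2 ^ d) × Fin β → Fields
    unpack₃ p b (δ , x) = fields p b δ x

    unpack₂ : Fin d → Fin K × Fin (2 ^ d * β) → Fields
    unpack₂ p (b , c) = unpack₃ p b (remQuot {2 ^ d} β c)

    unpack₁ : Fin d × Fin (K * (2 ^ d * β)) → Fields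
    unpack₁ (p , c) = unpack₂ p (remQuot {K} (2 ^ d * β) c)

  unpack : Class → Fields
  unpack c = unpack₁ (remQuot {d} (K * (2 ^ d * β)) c)

  pack : Fields → Class
  pack (fields p b δ x) = combine p (combine b (combine δ x))

  unpack-pack : ∀ F → unpack (pack F) ≡ F
  unpack-pack (fields p b δ x) =
    trans (cong unpack₁ (Fin.remQuot-combine p (combine b (combine δ x))))
    (trans (cong (unpack₂ p) (Fin.remQuot-combine b (combine δ x)))
           (cong (unpack₃ p b) (Fin.remQuot-combine δ x)))

  position-mono : ∀ {c c′} → c Fin.< c′ → position (unpack c) Fin.≤ position (unpack c′)
  position-mono {c} {c′} c<c′ = ℕ.≮⇒≥ λ p′<p → ℕ.<-asym c<c′
    (subst₂ Fin._<_ (Fin.combine-remQuot {d} (K * (2 ^ d * β)) c′)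
                    (Fin.combine-remQuot {d} (K * (2 ^ d * β)) c)
      (Fin.combine-monoˡ-< _ _ p′<p))

  record Edge (F : Fields) (v w : Word) : Set where
    field
      head   : v (block F) (position F) ≡ symbol F
      tail   : w (block F) (position F) ≢ symbol F
      above  : ∀ {a} → position F Fin.< a → v (block F) a ≡ w (block F) a
      agree  : ∀ {a} → differs F a ≡ zero → v (block F) a ≡ w (block F) a
      differ : ∀ {a} → differs F a ≡ suc zero → v (block F) a ≢ w (block F) a

  open Edge

  -- These are the positions where the ends of an edge of `F′` can differ: its last difference, or
  -- an earlier one recorded in its set. Equal positions form a separate case because reflexivity
  -- must hold even for a class whose set omits its own position.
  Hits : Fields → Fields → Set
  Hits F F′ = block F ≡ block F′ ×
    (position F ≡ position F′ ⊎
     position F Fin.< position F′ × differs F′ (position F) ≡ suc zero)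

  test : Fields → Word → Bool
  test F v = does (v (block F) (position F) Fin.≟ symbol F)

  hits? : ∀ F F′ → Dec (Hits F F′)
  hits? F F′ = (block F Fin.≟ block F′) ×-dec
    ((position F Fin.≟ position F′) ⊎-dec
     ((position F Fin.<? position F′) ×-dec (differs F′ (position F) Fin.≟ suc zero)))

  test-sound : ∀ F v → test F v ≡ true → v (block F) (position F) ≡ symbol F
  test-sound F v t with yes eq ← v (block F) (position F) Fin.≟ symbol F = eq

  hits-separate : ∀ F F′ {v w} → Hits F F′ → Edge F′ v w → ¬ (test F v ≡ true × test F w ≡ true)
  hits-separate F F′ {v} {w} (refl , inj₁ refl) e (tv , tw) =
    tail e (trans (test-sound F w tw) (trans (sym (test-sound F v tv)) (head e)))
  hits-separate F F′ {v} {w} (refl , inj₂ (_ , δ)) e (tv , tw) =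
    differ e δ (trans (test-sound F v tv) (sym (test-sound F w tw)))

  -- Without a hit, the queried position lies after the last difference, or before it and outside
  -- the recorded set; either way the two columns agree there.
  miss-constant : ∀ F F′ {v w} → block F ≡ block F′ → ¬ Hits F F′ → Edge F′ v w → test F v ≡ test F w
  miss-constant F F′ {v} {w} refl miss e = cong (λ x → does (x Fin.≟ symbol F)) same
    where
    same : v (block F) (position F) ≡ w (block F) (position F)
    same with Fin.<-cmp (position F) (position F′)
    ... | tri≈ _ eq _ = contradiction (refl , inj₁ eq) miss
    ... | tri> _ _ gt = above e gt
    ... | tri< lt _ _ with zero⊎one (differs F′ (position F))
    ...   | inj₁ δ = agree e δ
    ...   | inj₂ δ = contradiction (refl , inj₂ (lt , δ)) miss

  family : Family Word #classes K
  family = record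
    { Edge      = Edge ∘ unpack
    ; block     = block ∘ unpack
    ; test      = test ∘ unpack
    ; Hit       = λ c c′ → Hits (unpack c) (unpack c′)
    ; hit?      = λ c c′ → hits? (unpack c) (unpack c′)
    ; hit-refl  = λ _ → refl , inj₁ refl
    ; edge-head = λ e → dec-true (_ Fin.≟ _) (head e)
    ; edge-tail = λ e → dec-false (_ Fin.≟ _) (tail e)
    ; hit       = λ {c} {c′} → hits-separate (unpack c) (unpack c′)
    ; no-hit    = λ {c} {c′} → miss-constant (unpack c) (unpack c′)
    }

  open Coloring family public using (Proper; Colorable; Ordered; colorable)

  -- A hit at a strictly earlier position would contradict `position-mono`; a hit at an equal
  -- position is symmetric.
  ordered : ∀ {c c′} → c Fin.< c′ → Ordered c c′
  ordered c<c′ (B≡ , inj₁ p≡)       = sym B≡ , inj₁ (sym p≡)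
  ordered c<c′ (B≡ , inj₂ (p< , _)) = contradiction (position-mono c<c′) (ℕ.<⇒≱ p<)

  word : Fin ((β ^ d) ^ K) → Word
  word j B = finToFun (finToFun j B)

  separating-class : ∀ {j j′} → j ≢ j′ → ∃[ c ] Edge (unpack c) (word j) (word j′)
  separating-class {j} {j′} j≢j′
    with B , ≢B ← finToFun-differ {K} j≢j′
    with a₀ , ≢a₀ ← finToFun-differ {d} ≢B
    with a , ≢a , above ← last-difference (word j B) (word j′ B) ≢a₀ =
    pack F , subst (λ F → Edge F (word j) (word j′)) (sym (unpack-pack F)) edge
    where
    δ : Fin d → Fin 2
    δ b with word j B b Fin.≟ word j′ B b
    ... | yes _ = zero
    ... | no  _ = suc zero
    F : Fields
    F = fields a B (funToFin δ) (word j B a)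
    edge : Edge F (word j) (word j′)
    edge = record
      { head   = refl
      ; tail   = ≢a ∘ sym
      ; above  = above
      ; agree  = λ {b} eq → agree′ b (trans (sym (Fin.finToFun-funToFin δ b)) eq)
      ; differ = λ {b} eq → differ′ b (trans (sym (Fin.finToFun-funToFin δ b)) eq)
      }
      where
      agree′ : ∀ b → δ b ≡ zero → word j B b ≡ word j′ B b
      agree′ b eq with word j B b Fin.≟ word j′ B b
      ... | yes p = p
      differ′ : ∀ b → δ b ≡ suc zero → word j B b ≢ word j′ B b
      differ′ b eq with word j B b Fin.≟ word j′ B b
      ... | no ¬p = ¬p

-- Words with few pairwise agreements

below-average : ∀ {n} (F : Fin (suc n) → ℕ) → ∃[ s ] suc n * F s ≤ sum F
below-average {zero}  F = zero , ℕ.≤-refl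
below-average {suc n} F = case (below-average (F ∘ suc))
  where
  case : (∃[ s ] suc n * F (suc s) ≤ sum (F ∘ suc)) → ∃[ s ] suc (suc n) * F s ≤ sum F
  case (s , below) with ℕ.≤-total (F zero) (F (suc s))
  ... | inj₁ F₀≤Fₛ = zero , ℕ.+-monoʳ-≤ (F zero) (ℕ.≤-trans (ℕ.*-monoʳ-≤ (suc n) F₀≤Fₛ) below)
  ... | inj₂ Fₛ≤F₀ = suc s , ℕ.+-mono-≤ Fₛ≤F₀ below

term≤sum : ∀ {n} (F : Fin n → ℕ) i → F i ≤ sum F
term≤sum F zero    = ℕ.m≤m+n (F zero) _
term≤sum F (suc i) = ℕ.≤-trans (term≤sum (F ∘ suc) i) (ℕ.m≤n+m _ (F zero))

sum-ones : ∀ n → ∑[ i < n ] 1 ≡ n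
sum-ones zero    = refl
sum-ones (suc n) = cong suc (sum-ones n)

[_≟_] : ∀ {n} → Fin n → Fin n → ℕ
[ i ≟ j ] = if does (i Fin.≟ j) then 1 else 0

agreement : ∀ {D r} → (Fin D → Fin r) → (Fin D → Fin r) → ℕ
agreement f g = sum λ c → [ f c ≟ g c ]

length-filter-agreement : ∀ {D D′ r} (f g : Fin D → Fin r) (h : Fin D′ → Fin D) →
  length (filter (λ c → f c Fin.≟ g c) (tabulate h)) ≡ agreement (f ∘ h) (g ∘ h)
length-filter-agreement {D′ = zero}  f g h = refl
length-filter-agreement {D′ = suc _} f g h
  with ih ← length-filter-agreement f g (h ∘ suc) | does (f (h zero) Fin.≟ g (h zero))
... | true  = cong suc ih
... | false = ih

-- Just one symbol agrees with `h`, and it contributes `suc β` in place of 1.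
sum-power : ∀ {r} β (h : Fin r) → ∑[ s < r ] (suc β ^ [ s ≟ h ]) ≡ r + β
sum-power {suc r} β zero    = trans (cong₂ _+_ (ℕ.*-identityʳ (suc β)) (sum-ones r))
  (cong suc (ℕ.+-comm β r))
sum-power {suc r} β (suc h) = cong suc (sum-power β h)

-- The word is chosen symbol by symbol so that the total weight, each agreement
-- with word i multiplying the weight of i by 1 + β, grows by a factor of at
-- most 1 + β / r in each step.
greedy-word : ∀ D {r k} β (W : Fin k → ℕ) (g : Fin k → Fin D → Fin (suc r)) →
  ∃[ f ] suc r ^ D * ∑[ i < k ] (W i * suc β ^ agreement f (g i)) ≤ (suc r + β) ^ D * sum W
greedy-word zero    β W g = (λ ()) , ℕ.≤-reflexive (cong (1 *_) (sum-cong-≗ λ i → ℕ.*-identityʳ (W i)))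
greedy-word (suc D) {r} {k} β W g = extend (below-average load)
  where
  W′ : Fin (suc r) → Fin k → ℕ
  W′ s i = W i * suc β ^ [ s ≟ g i zero ]
  load : Fin (suc r) → ℕ
  load s = sum (W′ s)
  total : sum load ≡ (suc r + β) * sum W
  total = begin
    ∑[ s < suc r ] (∑[ i < k ] (W′ s i))                          ≡⟨ ∑-comm W′ ⟩
    ∑[ i < k ] (∑[ s < suc r ] (W′ s i))
      ≡⟨ sum-cong-≗ (λ i → *-distribˡ-sum (W i) (λ s → suc β ^ [ s ≟ g i zero ])) ⟨
    ∑[ i < k ] (W i * ∑[ s < suc r ] (suc β ^ [ s ≟ g i zero ]))
      ≡⟨ sum-cong-≗ (λ i → trans (cong (W i *_) (sum-power β (g i zero))) (ℕ.*-comm (W i) _)) ⟩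
    ∑[ i < k ] ((suc r + β) * W i)                            ≡⟨ *-distribˡ-sum (suc r + β) W ⟨
    (suc r + β) * sum W                                       ∎
    where open ≡-Reasoning
  extend : ∃[ s ] suc r * load s ≤ sum load →
    ∃[ f ] suc r ^ suc D * ∑[ i < k ] (W i * suc β ^ agreement f (g i)) ≤ (suc r + β) ^ suc D * sum W
  extend (s , below) with f , bound ← greedy-word D β (W′ s) (λ i → g i ∘ suc) = f′ , (begin
    suc r * suc r ^ D * ∑[ i < k ] (W i * suc β ^ agreement f′ (g i))
      ≡⟨ cong (suc r * suc r ^ D *_) (sum-cong-≗ split) ⟩
    suc r * suc r ^ D * T                     ≡⟨ ℕ.*-assoc (suc r) (suc r ^ D) T ⟩
    suc r * (suc r ^ D * T)                   ≤⟨ ℕ.*-monoʳ-≤ (suc r) bound ⟩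
    suc r * ((suc r + β) ^ D * load s)        ≡⟨ swap (suc r) ((suc r + β) ^ D) (load s) ⟩
    (suc r + β) ^ D * (suc r * load s)
      ≤⟨ ℕ.*-monoʳ-≤ ((suc r + β) ^ D) (ℕ.≤-trans below (ℕ.≤-reflexive total)) ⟩
    (suc r + β) ^ D * ((suc r + β) * sum W)   ≡⟨ rotate ((suc r + β) ^ D) (suc r + β) (sum W) ⟩
    (suc r + β) ^ suc D * sum W               ∎)
    where
    open ℕ.≤-Reasoning
    f′ : Fin (suc D) → Fin (suc r)
    f′ zero    = s
    f′ (suc c) = f c
    T : ℕ
    T = ∑[ i < k ] (W′ s i * suc β ^ agreement f (g i ∘ suc))
    split : ∀ i → W i * suc β ^ agreement f′ (g i) ≡ W′ s i * suc β ^ agreement f (g i ∘ suc)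
    split i = trans (cong (W i *_) (ℕ.^-distribˡ-+-* (suc β) [ s ≟ g i zero ] _)) (sym (ℕ.*-assoc (W i) _ _))
    swap : ∀ x y z → x * (y * z) ≡ y * (x * z)
    swap = solve-∀
    rotate : ∀ x y z → x * (y * z) ≡ y * x * z
    rotate = solve-∀

-- This is (1 + β / r)^j ≤ 1 + j / D without denominators: a further factor adds (D + j) β / r ≤ 2 D
-- β / r ≤ 1 to D + j.
power-growth : ∀ {D r β} → 2 * D * β ≤ r → ∀ j → j ≤ D → D * (r + β) ^ j ≤ (D + j) * r ^ j
power-growth {D} {r} {β} small zero    _ = ℕ.*-monoˡ-≤ 1 (ℕ.m≤m+n D 0)
power-growth {D} {r} {β} small (suc j) j<D = begin
  D * ((r + β) * (r + β) ^ j)   ≡⟨ swap D (r + β) ((r + β) ^ j) ⟩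
  (r + β) * (D * (r + β) ^ j)   ≤⟨ ℕ.*-monoʳ-≤ (r + β) (power-growth small j (ℕ.<⇒≤ j<D)) ⟩
  (r + β) * ((D + j) * r ^ j)   ≡⟨ ℕ.*-assoc (r + β) (D + j) (r ^ j) ⟨
  (r + β) * (D + j) * r ^ j     ≤⟨ ℕ.*-monoˡ-≤ (r ^ j) factor ⟩
  (D + suc j) * r * r ^ j       ≡⟨ ℕ.*-assoc (D + suc j) r (r ^ j) ⟩
  (D + suc j) * (r * r ^ j)     ∎
  where
  open ℕ.≤-Reasoning
  swap : ∀ x y z → x * (y * z) ≡ y * (x * z)
  swap = solve-∀
  factor : (r + β) * (D + j) ≤ (D + suc j) * r
  factor = begin
    (r + β) * (D + j)         ≡⟨ expand r β D j ⟩
    r * (D + j) + (D + j) * β ≤⟨ ℕ.+-monoʳ-≤ (r * (D + j)) (ℕ.*-monoˡ-≤ β (ℕ.+-monoʳ-≤ D (ℕ.<⇒≤ j<D))) ⟩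
    r * (D + j) + (D + D) * β ≡⟨ cong (λ x → r * (D + j) + (D + x) * β) (ℕ.+-identityʳ D) ⟨
    r * (D + j) + 2 * D * β   ≤⟨ ℕ.+-monoʳ-≤ (r * (D + j)) small ⟩
    r * (D + j) + r           ≡⟨ collect r D j ⟩
    (D + suc j) * r           ∎
    where
    expand : ∀ r β D j → (r + β) * (D + j) ≡ r * (D + j) + (D + j) * β
    expand = solve-∀
    collect : ∀ r D j → r * (D + j) + r ≡ (D + suc j) * r
    collect = solve-∀

[r+β]^D≤2r^D : ∀ D {r β} → 2 * D * β ≤ r → (r + β) ^ D ≤ 2 * r ^ D
[r+β]^D≤2r^D zero    small = s≤s z≤n
[r+β]^D≤2r^D D@(suc _) {r} {β} small = ℕ.*-cancelˡ-≤ D (begin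
  D * (r + β) ^ D   ≤⟨ power-growth small D ℕ.≤-refl ⟩
  (D + D) * r ^ D   ≡⟨ double D (r ^ D) ⟩
  D * (2 * r ^ D)   ∎)
  where
  open ℕ.≤-Reasoning
  double : ∀ x y → (x + x) * y ≡ x * (2 * y)
  double = solve-∀

-- Words are added one by one by `greedy-word` with unit weights. Over all `D` steps the total
-- weight at most doubles, to `2 * m`, whereas a single earlier word with more than `p` agreements
-- would already weigh at least `suc β ^ suc p`, which is larger.
code : ∀ m {r D β p} → 2 * D * β ≤ suc r → 2 * m ≤ suc β ^ suc p →
  ∃[ w ] ∀ (i i′ : Fin m) → i Fin.< i′ → agreement {D} {suc r} (w i) (w i′) ≤ p
code zero    small few = (λ ()) , λ ()
code (suc m) {r} {D} {β} {p} small few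
  with w , good ← code m {r} {D} {β} {p} small (ℕ.≤-trans (ℕ.*-monoʳ-≤ 2 (ℕ.n≤1+n m)) few)
  with f , bound ← greedy-word D β (λ _ → 1) w = w′ , good′
  where
  w′ : Fin (suc m) → Fin D → Fin (suc r)
  w′ zero    = f
  w′ (suc i) = w i
  T : ℕ
  T = ∑[ i < m ] (1 * suc β ^ agreement f (w i))
  T≤2m : T ≤ 2 * m
  T≤2m = ℕ.*-cancelˡ-≤ (suc r ^ D) {{ℕ.m^n≢0 (suc r) D}} (begin
    suc r ^ D * T                    ≤⟨ bound ⟩
    (suc r + β) ^ D * ∑[ i < m ] 1   ≡⟨ cong ((suc r + β) ^ D *_) (sum-ones m) ⟩
    (suc r + β) ^ D * m              ≤⟨ ℕ.*-monoˡ-≤ m ([r+β]^D≤2r^D D small) ⟩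
    2 * suc r ^ D * m                ≡⟨ rotate 2 (suc r ^ D) m ⟩
    suc r ^ D * (2 * m)              ∎)
    where
    open ℕ.≤-Reasoning
    rotate : ∀ x y z → x * y * z ≡ y * (x * z)
    rotate = solve-∀
  few-agreements : ∀ i → agreement f (w i) ≤ p
  few-agreements i = ℕ.≮⇒≥ λ p<a → ℕ.<-irrefl refl (begin-strict
    suc β ^ agreement f (w i)       ≡⟨ ℕ.*-identityˡ _ ⟨
    1 * suc β ^ agreement f (w i)   ≤⟨ term≤sum (λ i → 1 * suc β ^ agreement f (w i)) i ⟩
    T                               ≤⟨ T≤2m ⟩
    2 * m                           <⟨ ℕ.*-monoʳ-< 2 (ℕ.n<1+n m) ⟩
    2 * suc m                       ≤⟨ few ⟩
    suc β ^ suc p                   ≤⟨ ℕ.^-monoʳ-≤ (suc β) p<a ⟩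
    suc β ^ agreement f (w i)       ∎)
    where open ℕ.≤-Reasoning
  good′ : ∀ i i′ → i Fin.< i′ → agreement (w′ i) (w′ i′) ≤ p
  good′ zero    (suc i′) _    = few-agreements i′
  good′ (suc i) (suc i′) i<i′ = good i i′ (s≤s⁻¹ i<i′)

-- The grid

module Grid {r D n : ℕ}
  (base : {j j′ : Fin n} → j Fin.< j′ → Fin D)
  (word : Fin n → Fin D → Fin r)
  (separator : {i i′ : Fin n} → i Fin.< i′ → Fin n → Fin r)
  (separates : ∀ {i i′ j j′} (i<i′ : i Fin.< i′) (j<j′ : j Fin.< j′) →
               word i (base j<j′) ≡ word i′ (base j<j′) →
               separator i<i′ j ≢ separator i<i′ j′) where

  private
    Compare : Fin n → Fin n → Set
    Compare i i′ = Tri (i Fin.< i′) (i ≡ i′) (i′ Fin.< i)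

    -- The comparisons are arguments so that the lemmas can split on them. Between different rows
    -- the colour is read off at the endpoint in the smaller row, hence `j` or `j′`; this makes it
    -- symmetric.
    raw : ∀ {i j i′ j′} → Compare i i′ → Compare j j′ → .(Adj (i , j) (i′ , j′)) → Fin r
    raw {j = j}   (tri< i<i′ _ _) _               _ = separator i<i′ j
    raw {j′ = j′} (tri> _ _ i′<i) _               _ = separator i′<i j′
    raw {i = i}   (tri≈ _ _ _)    (tri< j<j′ _ _) _ = word i (base j<j′)
    raw {i = i}   (tri≈ _ _ _)    (tri> _ _ j′<j) _ = word i (base j′<j)
    raw           (tri≈ _ p _)    (tri≈ _ q _)    e = ⊥-elim-irr (proj₁ e (cong₂ _,_ p q))

    <-irr : ∀ {i i′ : Fin n} (p q : i Fin.< i′) → p ≡ q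
    <-irr = ℕ.<-irrelevant

    raw-column : ∀ {i j i′ j′} (t : Compare i i′) (s : Compare j j′) .(e : Adj (i , j) (i′ , j′))
                 (i<i′ : i Fin.< i′) → raw t s e ≡ separator i<i′ j
    raw-column {j = j} (tri< p _ _) _ e q = cong (λ p → separator p j) (<-irr p q)
    raw-column (tri≈ ¬p _ _) _ e q = contradiction q ¬p
    raw-column (tri> ¬p _ _) _ e q = contradiction q ¬p

    raw-row : ∀ {i j j′} (t : Compare i i) (s : Compare j j′) .(e : Adj (i , j) (i , j′))
              (j<j′ : j Fin.< j′) → raw t s e ≡ word i (base j<j′)
    raw-row (tri< _ ¬p _) s e q = contradiction refl ¬p
    raw-row (tri> _ ¬p _) s e q = contradiction refl ¬p
    raw-row {i} (tri≈ _ _ _) (tri< p _ _)  e q = cong (λ p → word i (base p)) (<-irr p q)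
    raw-row     (tri≈ _ _ _) (tri≈ ¬p _ _) e q = contradiction q ¬p
    raw-row     (tri≈ _ _ _) (tri> ¬p _ _) e q = contradiction q ¬p

    raw-symmetric : ∀ {i j i′ j′} (t : Compare i i′) (s : Compare j j′) (t′ : Compare i′ i) (s′ : Compare j′ j)
                    .(e : Adj (i , j) (i′ , j′)) .(e′ : Adj (i′ , j′) (i , j)) → raw t s e ≡ raw t′ s′ e′
    raw-symmetric {j = j}   (tri< p _ _) _ (tri> _ _ q) _ e e′ = cong (λ p → separator p j) (<-irr p q)
    raw-symmetric           (tri< p _ _) _ (tri< _ _ ¬p) _ e e′ = contradiction p ¬p
    raw-symmetric           (tri< p _ _) _ (tri≈ _ _ ¬p) _ e e′ = contradiction p ¬p
    raw-symmetric {j′ = j′} (tri> _ _ p) _ (tri< q _ _) _ e e′ = cong (λ p → separator p j′) (<-irr p q)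
    raw-symmetric           (tri> _ _ p) _ (tri> ¬p _ _) _ e e′ = contradiction p ¬p
    raw-symmetric           (tri> _ _ p) _ (tri≈ ¬p _ _) _ e e′ = contradiction p ¬p
    raw-symmetric           (tri≈ _ refl _) s (tri< _ ¬p _) s′ e e′ = contradiction refl ¬p
    raw-symmetric           (tri≈ _ refl _) s (tri> _ ¬p _) s′ e e′ = contradiction refl ¬p
    raw-symmetric {i}       (tri≈ _ refl _) (tri< p _ _) (tri≈ _ _ _) (tri> _ _ q) e e′ =
      cong (λ p → word i (base p)) (<-irr p q)
    raw-symmetric {i}       (tri≈ _ refl _) (tri> _ _ p) (tri≈ _ _ _) (tri< q _ _) e e′ =
      cong (λ p → word i (base p)) (<-irr p q)
    raw-symmetric           (tri≈ _ refl _) (tri< p _ _) (tri≈ _ _ _) (tri< _ _ ¬p) e e′ = contradiction p ¬p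
    raw-symmetric           (tri≈ _ refl _) (tri< p _ _) (tri≈ _ _ _) (tri≈ _ _ ¬p) e e′ = contradiction p ¬p
    raw-symmetric           (tri≈ _ refl _) (tri> _ _ p) (tri≈ _ _ _) (tri> ¬p _ _) e e′ = contradiction p ¬p
    raw-symmetric           (tri≈ _ refl _) (tri> _ _ p) (tri≈ _ _ _) (tri≈ ¬p _ _) e e′ = contradiction p ¬p
    raw-symmetric           (tri≈ _ refl _) (tri≈ _ refl _) _ _ e e′ = ⊥-elim-irr (proj₁ e refl)

  coloring : EdgeColoring r n n
  coloring = record
    { color     = λ (i , j) (i′ , j′) e → raw (Fin.<-cmp i i′) (Fin.<-cmp j j′) e
    ; symmetric = λ (i , j) (i′ , j′) → raw-symmetric
        (Fin.<-cmp i i′) (Fin.<-cmp j j′) (Fin.<-cmp i′ i) (Fin.<-cmp j′ j)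
    }

  no-alternating-rectangle : ¬ HasAlternatingRectangle coloring
  no-alternating-rectangle (i , i′ , j , j′ , i<i′ , j<j′ , columns , rows) =
    separates i<i′ j<j′
      (trans (sym (raw-row {i} (Fin.<-cmp i i) (Fin.<-cmp j j′) (sameRow i j<j′) j<j′))
        (trans rows (raw-row {i′} (Fin.<-cmp i′ i′) (Fin.<-cmp j j′) (sameRow i′ j<j′) j<j′)))
      (trans (sym (raw-column (Fin.<-cmp i i′) (Fin.<-cmp j j) (sameCol j i<i′) i<i′))
        (trans columns (raw-column (Fin.<-cmp i i′) (Fin.<-cmp j′ j′) (sameCol j′ i<i′) i<i′)))

  avoidable : ¬ Unavoidable r n
  avoidable unavoidable = no-alternating-rectangle (unavoidable coloring)

-- By the first two bounds there are codewords agreeing in at most `k * t` places. The column pairs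
-- on which two rows agree thus lie in at most `k * t` classes, and a proper colouring of their
-- union, within `suc r` colours by the last bound, colours the edges between these rows.
not-unavoidable : ∀ {r K d β t k b n} → let open Blocks K d β using (#classes) in
  2 * #classes * b ≤ suc r →
  2 * n ≤ suc b ^ suc (k * t) →
  n ≤ (β ^ d) ^ K →
  suc t ^ k * (2 ^ t) ^ K ≤ suc r →
  ¬ Unavoidable (suc r) n
not-unavoidable {r} {K} {d} {β} {t} {k} {b} {n} alphabet rows columns colours =
  Grid.avoidable base word separator separates
  where
  open Blocks K d β renaming (word to vertex)
  column : Fin n → Fin ((β ^ d) ^ K)
  column j = inject≤ j columns
  class : ∀ {j j′ : Fin n} → j Fin.< j′ → ∃[ c ] Edge (unpack c) (vertex (column j)) (vertex (column j′))
  class j<j′ = separating-class λ eq → Fin.<⇒≢ j<j′ (Fin.inject≤-injective columns columns _ _ eq)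
  base : ∀ {j j′ : Fin n} → j Fin.< j′ → Fin #classes
  base j<j′ = proj₁ (class j<j′)
  codewords : ∃[ w ] ∀ (i i′ : Fin n) → i Fin.< i′ → agreement {#classes} {suc r} (w i) (w i′) ≤ k * t
  codewords = code n alphabet rows
  word : Fin n → Fin #classes → Fin (suc r)
  word = proj₁ codewords
  common : Fin n → Fin n → List (Fin #classes)
  common i i′ = filter (λ c → word i c Fin.≟ word i′ c) (allFin #classes)
  coloured : ∀ {i i′} → i Fin.< i′ → Colorable (suc r) (common i i′)
  coloured {i} {i′} i<i′ = Coloring.weaken family colours
    (colorable t k (common i i′)
      (AllPairs.filter⁺ (λ c → word i c Fin.≟ word i′ c) (AllPairs.tabulate⁺-< ordered))
      (ℕ.≤-trans (ℕ.≤-reflexive (length-filter-agreement (word i) (word i′) id))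
                 (proj₂ codewords i i′ i<i′)))
  separator : ∀ {i i′ : Fin n} → i Fin.< i′ → Fin n → Fin (suc r)
  separator i<i′ j = proj₁ (coloured i<i′) (vertex (column j))
  separates : ∀ {i i′ j j′} (i<i′ : i Fin.< i′) (j<j′ : j Fin.< j′) →
              word i (base j<j′) ≡ word i′ (base j<j′) → separator i<i′ j ≢ separator i<i′ j′
  separates {i} {i′} i<i′ j<j′ same = All.lookup (proj₂ (coloured i<i′))
    (∈-filter⁺ (λ c → word i c Fin.≟ word i′ c) (∈-allFin _) same) _ _ (proj₂ (class j<j′))

-- Choice of parameters

n≤2^n : ∀ n → n ≤ 2 ^ n
n≤2^n n = ℕ.<⇒≤ (n<2^n n)
  where
  n<2^n : ∀ n → n < 2 ^ n
  n<2^n zero    = s≤s z≤n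
  n<2^n (suc n) = begin-strict
    suc n          ≤⟨ n<2^n n ⟩
    2 ^ n          <⟨ ℕ.m<m+n (2 ^ n) (ℕ.≤-<-trans z≤n (n<2^n n)) ⟩
    2 ^ n + 2 ^ n  ≡⟨ cong (2 ^ n +_) (ℕ.+-identityʳ (2 ^ n)) ⟨
    2 ^ suc n      ∎
    where open ℕ.≤-Reasoning

-- The columns have k blocks of y symbols from an alphabet of size 2 ^ y.
grid-lower-bound : ∀ r s k .{{_ : NonZero s}} .{{_ : NonZero k}} → let y = s * s * (k * k) in
  2 ^ (10 * y) ≤ r → suc (s * s * k) ≤ 2 ^ (9 * (s * s)) → 2 ^ (y * y * k) < G r
grid-lower-bound zero s k large few = contradiction large (ℕ.<⇒≱ (ℕ.m^n>0 2 (10 * (s * s * (k * k)))))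
grid-lower-bound (suc r) s k large few = ℕ.≰⇒> λ small →
  -- The permitted number of agreements is `k * k * t`, which equals `y * k`, so the bounds on rows
  -- and on columns both reach `2 ^ (y * y * k)`.
  not-unavoidable {r} {k} {y} {2 ^ y} {t} {k * k} {2 ^ y} alphabet (rows small) (columns small) colours
    (proj₁ (G-isLeast (suc r)))
  where
  open ℕ.≤-Reasoning
  y t : ℕ
  y = s * s * (k * k)
  t = s * s * k
  instance
    y≢0 : NonZero y
    y≢0 = ℕ.m*n≢0 (s * s) (k * k) {{ℕ.m*n≢0 s s}} {{ℕ.m*n≢0 k k}}
  k≤y : k ≤ y
  k≤y = ℕ.≤-trans (ℕ.m≤m*n k k) (ℕ.m≤n*m (k * k) (s * s) {{ℕ.m*n≢0 s s}})
  alphabet : 2 * (y * (k * (2 ^ y * 2 ^ y))) * 2 ^ y ≤ suc r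
  alphabet = begin
    2 * (y * (k * (2 ^ y * 2 ^ y))) * 2 ^ y
      ≤⟨ ℕ.*-monoˡ-≤ (2 ^ y) (ℕ.*-mono-≤ (ℕ.^-monoʳ-≤ 2 (>-nonZero⁻¹ y))
      (ℕ.*-mono-≤ (n≤2^n y) (ℕ.*-monoˡ-≤ (2 ^ y * 2 ^ y) (ℕ.≤-trans k≤y (n≤2^n y))))) ⟩
    2 ^ y * (2 ^ y * (2 ^ y * (2 ^ y * 2 ^ y))) * 2 ^ y ≡⟨ sixth (2 ^ y) ⟩
    (2 ^ y) ^ 6                                       ≡⟨ ℕ.^-*-assoc 2 y 6 ⟩
    2 ^ (y * 6)                                       ≡⟨ cong (2 ^_) (ℕ.*-comm y 6) ⟩
    2 ^ (6 * y)                                       ≤⟨ ℕ.^-monoʳ-≤ 2 (ℕ.*-monoˡ-≤ y (ℕ.m≤m+n 6 4)) ⟩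
    2 ^ (10 * y)                                      ≤⟨ large ⟩
    suc r                                             ∎
    where
    sixth : ∀ x → x * (x * (x * (x * x))) * x ≡ x * (x * (x * (x * (x * (x * 1)))))
    sixth = solve-∀
  rows : ∀ {n} → n ≤ 2 ^ (y * y * k) → 2 * n ≤ suc (2 ^ y) ^ suc (k * k * t)
  rows {n} small = begin
    -- The extra one in the exponent leaves a factor `2 ^ y` to absorb the 2.
    2 * n                              ≤⟨ ℕ.*-mono-≤ (ℕ.^-monoʳ-≤ 2 (>-nonZero⁻¹ y)) small ⟩
    2 ^ y * 2 ^ (y * y * k)            ≡⟨ cong (λ e → 2 ^ y * 2 ^ e) (exponent s k) ⟩
    2 ^ y * 2 ^ (y * (k * k * t))      ≡⟨ cong (2 ^ y *_) (ℕ.^-*-assoc 2 y (k * k * t)) ⟨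
    (2 ^ y) ^ suc (k * k * t)          ≤⟨ ℕ.^-monoˡ-≤ (suc (k * k * t)) (ℕ.n≤1+n (2 ^ y)) ⟩
    suc (2 ^ y) ^ suc (k * k * t)      ∎
    where
    exponent : ∀ s k → s * s * (k * k) * (s * s * (k * k)) * k ≡ s * s * (k * k) * (k * k * (s * s * k))
    exponent = solve-∀
  columns : ∀ {n} → n ≤ 2 ^ (y * y * k) → n ≤ ((2 ^ y) ^ y) ^ k
  columns {n} small = begin
    n                  ≤⟨ small ⟩
    2 ^ (y * y * k)    ≡⟨ ℕ.^-*-assoc 2 (y * y) k ⟨
    (2 ^ (y * y)) ^ k  ≡⟨ cong (_^ k) (ℕ.^-*-assoc 2 y y) ⟨
    ((2 ^ y) ^ y) ^ k  ∎
  colours : suc t ^ (k * k) * (2 ^ t) ^ k ≤ suc r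
  colours = begin
    suc t ^ (k * k) * (2 ^ t) ^ k                ≤⟨ ℕ.*-monoˡ-≤ ((2 ^ t) ^ k) (ℕ.^-monoˡ-≤ (k * k) few) ⟩
    (2 ^ (9 * (s * s))) ^ (k * k) * (2 ^ t) ^ k
      ≡⟨ cong₂ _*_ (ℕ.^-*-assoc 2 (9 * (s * s)) (k * k)) (ℕ.^-*-assoc 2 t k) ⟩
    2 ^ (9 * (s * s) * (k * k)) * 2 ^ (t * k)    ≡⟨ ℕ.^-distribˡ-+-* 2 (9 * (s * s) * (k * k)) (t * k) ⟨
    -- The queries contribute `9 * y` to the exponent and the parities `y`.
    2 ^ (9 * (s * s) * (k * k) + t * k)          ≡⟨ cong (2 ^_) (exponent s k) ⟩
    2 ^ (10 * y)                                 ≤⟨ large ⟩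
    suc r                                        ∎
    where
    exponent : ∀ s k → 9 * (s * s) * (k * k) + s * s * k * k ≡ 10 * (s * s * (k * k))
    exponent = solve-∀

-- The search descends from `suc x`, where `f` exceeds `x`, and is stopped at the latest by
-- `f 0 ≤ x`.
bracket : ∀ (f : ℕ → ℕ) → (∀ n → n ≤ f n) → ∀ x → f 0 ≤ x → ∃[ n ] f n ≤ x × x < f (suc n)
bracket f grows x f₀≤x = search (suc x) (grows (suc x))
  where
  search : ∀ n → x < f n → ∃[ n ] f n ≤ x × x < f (suc n)
  search zero    x<f₀ = contradiction f₀≤x (ℕ.<⇒≱ x<f₀)
  search (suc n) x<f  with f n ℕ.≤? x
  ... | yes fₙ≤x = n , fₙ≤x , x<f
  ... | no  fₙ≰x = search n (ℕ.≰⇒> fₙ≰x)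

-- s ~ √(log log r) and s k ~ √(log r).
record Scales (r : ℕ) : Set where
  field
    ℓ s k     : ℕ
    s≥2       : 2 ≤ s
    k≥1       : 1 ≤ k
    2^ℓ≤r     : 2 ^ ℓ ≤ r
    r<2^1+ℓ   : r < 2 ^ suc ℓ
    2^ss≤ℓ    : 16 * 2 ^ (s * s) ≤ ℓ
    sk-lower  : 10 * (s * s * (k * k)) ≤ ℓ
    sk-upper  : ℓ < 40 * (s * s * (k * k))
    few       : suc (s * s * k) ≤ 2 ^ (9 * (s * s))

-- Three brackets fix `ℓ`, then `s`, then `k`. The threshold gives `256 ≤ ℓ`, and 256 = 16 * 2 ^ (2
-- * 2) forces `2 ≤ s`.
scales : ∀ r → 2 ^ 256 ≤ r → Scales r
scales r large
  with ℓ , 2^ℓ≤r , r<2^1+ℓ ← bracket (2 ^_) n≤2^n r (ℕ.≤-trans (ℕ.m^n>0 2 256) large)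
  = record
  { ℓ = ℓ ; s = s ; k = k ; s≥2 = s≥2 ; k≥1 = k≥1 ; 2^ℓ≤r = 2^ℓ≤r ; r<2^1+ℓ = r<2^1+ℓ
  ; 2^ss≤ℓ = 2^ss≤ℓ ; sk-lower = sk-lower ; sk-upper = sk-upper ; few = few }
  where
  open ℕ.≤-Reasoning
  256≤ℓ : 256 ≤ ℓ
  256≤ℓ = ℕ.≮⇒≥ λ ℓ<256 → ℕ.<⇒≱ r<2^1+ℓ (ℕ.≤-trans (ℕ.^-monoʳ-≤ 2 ℓ<256) large)
  f : ℕ → ℕ
  f s = 16 * 2 ^ (s * s)
  grows : ∀ s → s ≤ f s
  grows zero = z≤n
  grows s@(suc _) = ℕ.≤-trans (ℕ.m≤m*n s s) (ℕ.≤-trans (n≤2^n (s * s)) (ℕ.m≤n*m _ 16))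
  s-bracket : ∃[ s ] f s ≤ ℓ × ℓ < f (suc s)
  s-bracket = bracket f grows ℓ (ℕ.≤-trans (ℕ.m≤m+n 16 240) 256≤ℓ)
  s : ℕ
  s = proj₁ s-bracket
  2^ss≤ℓ : 16 * 2 ^ (s * s) ≤ ℓ
  2^ss≤ℓ = proj₁ (proj₂ s-bracket)
  s≥2 : 2 ≤ s
  s≥2 = ℕ.≮⇒≥ λ s<2 → ℕ.<⇒≱ (proj₂ (proj₂ s-bracket)) (begin
    f (suc s)  ≤⟨ ℕ.*-monoʳ-≤ 16 (ℕ.^-monoʳ-≤ 2 (ℕ.*-mono-≤ s<2 s<2)) ⟩
    256        ≤⟨ 256≤ℓ ⟩
    ℓ          ∎)
  instance
    s≢0 : NonZero s
    s≢0 = >-nonZero (ℕ.<⇒≤ s≥2)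
    ss≢0 : NonZero (s * s)
    ss≢0 = ℕ.m*n≢0 s s
  g : ℕ → ℕ
  g k = 10 * (s * s * (k * k))
  g-grows : ∀ k → k ≤ g k
  g-grows zero = z≤n
  g-grows k@(suc _) = ℕ.≤-trans (ℕ.m≤m*n k k) (ℕ.≤-trans (ℕ.m≤n*m (k * k) (s * s)) (ℕ.m≤n*m _ 10))
  k-bracket : ∃[ k ] g k ≤ ℓ × ℓ < g (suc k)
  k-bracket = bracket g g-grows ℓ (ℕ.≤-trans (ℕ.≤-reflexive (cong (10 *_) (ℕ.*-zeroʳ (s * s)))) z≤n)
  k : ℕ
  k = proj₁ k-bracket
  sk-lower : g k ≤ ℓ
  sk-lower = proj₁ (proj₂ k-bracket)
  k≥1 : 1 ≤ k
  k≥1 = ℕ.≮⇒≥ λ k<1 → ℕ.<⇒≱ (proj₂ (proj₂ k-bracket)) (begin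
    10 * (s * s * (suc k * suc k))  ≤⟨ ℕ.*-monoʳ-≤ 10 (ℕ.*-monoʳ-≤ (s * s) (ℕ.*-mono-≤ k<1 k<1)) ⟩
    10 * (s * s * 1)                ≡⟨ cong (10 *_) (ℕ.*-identityʳ (s * s)) ⟩
    10 * (s * s)                    ≤⟨ ℕ.*-mono-≤ (ℕ.m≤m+n 10 6) (n≤2^n (s * s)) ⟩
    16 * 2 ^ (s * s)                ≤⟨ 2^ss≤ℓ ⟩
    ℓ                               ∎)
  1+k≤2k : suc k ≤ k + k
  1+k≤2k = ℕ.+-monoˡ-≤ k k≥1
  sk-upper : ℓ < 40 * (s * s * (k * k))
  sk-upper = begin-strict
    ℓ                                   <⟨ proj₂ (proj₂ k-bracket) ⟩
    10 * (s * s * (suc k * suc k))      ≤⟨ ℕ.*-monoʳ-≤ 10 (ℕ.*-monoʳ-≤ (s * s) (ℕ.*-mono-≤ 1+k≤2k 1+k≤2k)) ⟩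
    10 * (s * s * ((k + k) * (k + k)))  ≡⟨ double s k ⟩
    40 * (s * s * (k * k))              ∎
    where
    double : ∀ s k → 10 * (s * s * ((k + k) * (k + k))) ≡ 40 * (s * s * (k * k))
    double = solve-∀
  few : suc (s * s * k) ≤ 2 ^ (9 * (s * s))
  few = begin
    suc (s * s * k)                      ≤⟨ s≤s (ℕ.*-monoʳ-≤ (s * s) (ℕ.m≤m*n k k {{>-nonZero k≥1}})) ⟩
    suc (s * s * (k * k))                ≤⟨ s≤s (ℕ.m≤n*m _ 10) ⟩
    suc (10 * (s * s * (k * k)))         ≤⟨ s≤s sk-lower ⟩
    suc ℓ                                ≤⟨ proj₂ (proj₂ s-bracket) ⟩
    2 ^ 4 * 2 ^ (suc s * suc s)          ≡⟨ ℕ.^-distribˡ-+-* 2 4 (suc s * suc s) ⟨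
    -- As `2 ≤ s`, the 4 is at most `s * s` and `suc s` at most `s + s`.
    2 ^ (4 + suc s * suc s)
      ≤⟨ ℕ.^-monoʳ-≤ 2 (ℕ.+-mono-≤ (ℕ.*-mono-≤ s≥2 s≥2) (ℕ.*-mono-≤ 1+s≤2s 1+s≤2s)) ⟩
    2 ^ (s * s + (s + s) * (s + s))      ≡⟨ cong (2 ^_) (five s) ⟩
    2 ^ (5 * (s * s))                    ≤⟨ ℕ.^-monoʳ-≤ 2 (ℕ.*-monoˡ-≤ (s * s) (ℕ.m≤m+n 5 4)) ⟩
    2 ^ (9 * (s * s))                    ∎
    where
    1+s≤2s : suc s ≤ s + s
    1+s≤2s = ℕ.+-monoˡ-≤ s (ℕ.<⇒≤ s≥2)
    five : ∀ s → s * s + (s + s) * (s + s) ≡ 5 * (s * s)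
    five = solve-∀

-- Estimates for real numbers

-- ⟦ n ⟧ has denominator 1 definitionally, unlike + n / 1.
⟦_⟧ : ℕ → ℚ
⟦ n ⟧ = mkℚ (ℤ.+ n) 0 (coprime-sym (1-coprimeTo n))

/1≡⟦⟧ : ∀ n → ℤ.+ n ℚ./ 1 ≡ ⟦ n ⟧
/1≡⟦⟧ n = ℚ.normalize-coprime (coprime-sym (1-coprimeTo n))

⟦⟧-* : ∀ m n → ⟦ m ⟧ ℚ.* ⟦ n ⟧ ≡ ⟦ m * n ⟧
⟦⟧-* m n = trans (cong (ℚ._/ 1) (sym (ℤ.pos-* m n))) (/1≡⟦⟧ (m * n))

⟦⟧-< : ∀ {m n} → m < n → ⟦ m ⟧ ℚ.< ⟦ n ⟧
⟦⟧-< {m} {n} m<n = ℚ.*<* (subst₂ ℤ._<_ (sym (ℤ.*-identityʳ (ℤ.+ m))) (sym (ℤ.*-identityʳ (ℤ.+ n))) (ℤ.+<+ m<n))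

⟦⟧-≤ : ∀ {m n} → m ≤ n → ⟦ m ⟧ ℚ.≤ ⟦ n ⟧
⟦⟧-≤ {m} {n} m≤n = ℚ.*≤* (subst₂ ℤ._≤_ (sym (ℤ.*-identityʳ (ℤ.+ m))) (sym (ℤ.*-identityʳ (ℤ.+ n))) (ℤ.+≤+ m≤n))

2^ℤ-⟦⟧ : ∀ n → 2^ℤ (ℤ.+ n) ≡ ⟦ 2 ^ n ⟧
2^ℤ-⟦⟧ zero    = refl
2^ℤ-⟦⟧ (suc n) = trans (cong (⟦ 2 ⟧ ℚ.*_) (2^ℤ-⟦⟧ n)) (⟦⟧-* 2 (2 ^ n))

*-mono-≤ : ∀ {p q r s} → 0ℚ ℚ.≤ p → p ℚ.≤ q → 0ℚ ℚ.≤ r → r ℚ.≤ s → p ℚ.* r ℚ.≤ q ℚ.* s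
*-mono-≤ {p} {q} {r} {s} 0≤p p≤q 0≤r r≤s = ℚ.≤-trans
  (ℚ.*-monoʳ-≤-nonNeg r {{ℚ.nonNegative 0≤r}} p≤q)
  (ℚ.*-monoˡ-≤-nonNeg q {{ℚ.nonNegative (ℚ.≤-trans 0≤p p≤q)}} r≤s)

-- Products of cuts need bounds on both sides of each factor. With nonnegative bounds, the least of
-- the four products in `_*ᴿ_` is that of the lower ends and the greatest that of the upper ends.
record Between (x : Cut) (a b : ℚ) : Set where
  constructor between
  field
    above : lower x a
    below : upper x b
    0≤a   : 0ℚ ℚ.≤ a
    a≤b   : a ℚ.≤ b

open Between

fromℕ-between : ∀ {l m n} → l < m → m < n → Between (fromℕ m) ⟦ l ⟧ ⟦ n ⟧
fromℕ-between {l} {m} {n} l<m m<n rewrite /1≡⟦⟧ m =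
  between (⟦⟧-< l<m) (⟦⟧-< m<n) (⟦⟧-≤ z≤n) (⟦⟧-≤ (ℕ.<⇒≤ (ℕ.<-trans l<m m<n)))

module _ {x y a b c d} (X : Between x a b) (Y : Between y c d) where

  private
    0≤b = ℚ.≤-trans (0≤a X) (a≤b X)
    0≤d = ℚ.≤-trans (0≤a Y) (a≤b Y)

  *ᴿ-below : ∀ {q} → b ℚ.* d ℚ.< q → upper (x *ᴿ y) q
  *ᴿ-below bd<q = a , b , c , d , above X , below X , above Y , below Y
    , ℚ.≤-<-trans (*-mono-≤ (0≤a X) (a≤b X) (0≤a Y) (a≤b Y)) bd<q
    , ℚ.≤-<-trans (*-mono-≤ (0≤a X) (a≤b X) 0≤d ℚ.≤-refl) bd<q
    , ℚ.≤-<-trans (*-mono-≤ 0≤b ℚ.≤-refl (0≤a Y) (a≤b Y)) bd<q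
    , bd<q

  *ᴿ-between : ∀ {p q} → 0ℚ ℚ.≤ p → p ℚ.< a ℚ.* c → b ℚ.* d ℚ.< q → Between (x *ᴿ y) p q
  *ᴿ-between 0≤p p<ac bd<q = between
    (a , b , c , d , above X , below X , above Y , below Y
    , p<ac
    , ℚ.<-≤-trans p<ac (*-mono-≤ (0≤a X) ℚ.≤-refl (0≤a Y) (a≤b Y))
    , ℚ.<-≤-trans p<ac (*-mono-≤ (0≤a X) (a≤b X) (0≤a Y) ℚ.≤-refl)
    , ℚ.<-≤-trans p<ac (*-mono-≤ (0≤a X) (a≤b X) (0≤a Y) (a≤b Y)))
    (*ᴿ-below bd<q)
    0≤p
    (ℚ.<⇒≤ (ℚ.<-trans p<ac (ℚ.≤-<-trans (*-mono-≤ (0≤a X) (a≤b X) (0≤a Y) (a≤b Y)) bd<q)))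

¼ : ℚ
¼ = ℤ.+ 1 ℚ./ 4

-- The lower end only serves to keep the power positive: starting below 1, it survives
-- multiplication by `a ≥ 2`. The factor 4 leaves room above 1 and, like ¼, is a square, which suits
-- a later square root.
^ᴿ-between : ∀ {x a b} u → 2 ≤ a → b < u → Between x ⟦ a ⟧ ⟦ b ⟧ → ∀ n → Between (x ^ᴿ n) ¼ ⟦ 4 * u ^ n ⟧
^ᴿ-between u 2≤a b<u X zero = between
  (from-yes (¼ ℚ.<? 1ℚ)) (from-yes (1ℚ ℚ.<? ⟦ 4 ⟧)) (from-yes (0ℚ ℚ.≤? ¼)) (from-yes (¼ ℚ.≤? ⟦ 4 ⟧))
^ᴿ-between {a = a} {b} u 2≤a b<u X (suc n) = *ᴿ-between X (^ᴿ-between u 2≤a b<u X n)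
  (from-yes (0ℚ ℚ.≤? ¼)) (ℚ.<-≤-trans (from-yes (¼ ℚ.<? ⟦ 2 ⟧ ℚ.* ¼)) (ℚ.*-monoʳ-≤-nonNeg ¼ (⟦⟧-≤ 2≤a)))
  (subst (ℚ._< ⟦ 4 * u ^ suc n ⟧) (sym (⟦⟧-* b (4 * u ^ n))) (⟦⟧-< (begin-strict
    b * (4 * u ^ n) <⟨ ℕ.*-monoˡ-< (4 * u ^ n) {{ℕ.m*n≢0 4 (u ^ n) {{_}} {{ℕ.m^n≢0 u n}}}} b<u ⟩
    u * (4 * u ^ n) ≡⟨ swap u (u ^ n) ⟩
    4 * u ^ suc n   ∎)))
  where
  open ℕ.≤-Reasoning
  instance
    u≢0 : NonZero u
    u≢0 = >-nonZero (ℕ.≤-<-trans z≤n b<u)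
  swap : ∀ u v → u * (4 * v) ≡ 4 * (u * v)
  swap = solve-∀

√-between : ∀ {x a b} → Between x (a ℚ.* a) (b ℚ.* b) → 0ℚ ℚ.≤ a → 0ℚ ℚ.< b → a ℚ.≤ b → Between (√ x) a b
√-between X 0≤a 0<b a≤b = between (inj₂ (above X)) (0<b , below X) 0≤a a≤b

√-between-⟦⟧ : ∀ {x m n} → Between x ⟦ m * m ⟧ ⟦ n * n ⟧ → m ≤ n → 0 < n → Between (√ x) ⟦ m ⟧ ⟦ n ⟧
√-between-⟦⟧ {m = m} {n} X m≤n 0<n = √-between
  (subst₂ (Between _) (sym (⟦⟧-* m m)) (sym (⟦⟧-* n n)) X) (⟦⟧-≤ z≤n) (⟦⟧-< 0<n) (⟦⟧-≤ m≤n)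

-- An integer has denominator 1, so `log₂` compares with `x ^ᴿ 1`, a product with the cut 1. The
-- factors 4 and 2 pay for enclosing that cut between ½ and 2.
log₂-between : ∀ {x a b m n} → Between x ⟦ a ⟧ ⟦ b ⟧ → 4 * 2 ^ m ≤ a → 2 * b < 2 ^ n → m ≤ n →
               Between (log₂ x) ⟦ m ⟧ ⟦ n ⟧
log₂-between {x} {a} {b} {m} {n} X low high m≤n = between
  (subst (lower (x ^ᴿ 1)) (sym (2^ℤ-⟦⟧ m)) (above product))
  (subst (upper (x ^ᴿ 1)) (sym (2^ℤ-⟦⟧ n)) (below product))
  (⟦⟧-≤ z≤n) (⟦⟧-≤ m≤n)
  where
  one : Between (fromℚ 1ℚ) ½ ⟦ 2 ⟧
  one = between (from-yes (½ ℚ.<? 1ℚ)) (from-yes (1ℚ ℚ.<? ⟦ 2 ⟧)) (from-yes (0ℚ ℚ.≤? ½)) (from-yes (½ ℚ.≤? ⟦ 2 ⟧))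
  2^m<a½ : ⟦ 2 ^ m ⟧ ℚ.< ⟦ a ⟧ ℚ.* ½
  2^m<a½ = begin-strict
    ⟦ 2 ^ m ⟧                          <⟨ ⟦⟧-< (ℕ.m<m*n (2 ^ m) 2 {{ℕ.m^n≢0 2 m}} ℕ.≤-refl) ⟩
    ⟦ 2 ^ m * 2 ⟧                      ≡⟨ ⟦⟧-* (2 ^ m) 2 ⟨
    ⟦ 2 ^ m ⟧ ℚ.* ⟦ 2 ⟧                ≡⟨⟩
    ⟦ 2 ^ m ⟧ ℚ.* (⟦ 4 ⟧ ℚ.* ½)        ≡⟨ ℚ.*-assoc ⟦ 2 ^ m ⟧ ⟦ 4 ⟧ ½ ⟨
    ⟦ 2 ^ m ⟧ ℚ.* ⟦ 4 ⟧ ℚ.* ½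
      ≡⟨ cong (ℚ._* ½) (trans (⟦⟧-* (2 ^ m) 4) (cong ⟦_⟧ (ℕ.*-comm (2 ^ m) 4))) ⟩
    ⟦ 4 * 2 ^ m ⟧ ℚ.* ½                ≤⟨ ℚ.*-monoʳ-≤-nonNeg ½ (⟦⟧-≤ low) ⟩
    ⟦ a ⟧ ℚ.* ½                        ∎
    where open ℚ.≤-Reasoning
  b2<2^n : ⟦ b ⟧ ℚ.* ⟦ 2 ⟧ ℚ.< ⟦ 2 ^ n ⟧
  b2<2^n = subst (ℚ._< ⟦ 2 ^ n ⟧) (trans (cong ⟦_⟧ (ℕ.*-comm 2 b)) (sym (⟦⟧-* b 2))) (⟦⟧-< high)
  product : Between (x ^ᴿ 1) ⟦ 2 ^ m ⟧ ⟦ 2 ^ n ⟧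
  product = *ᴿ-between X one (⟦⟧-≤ z≤n) 2^m<a½ b2<2^n

^5/2-between : ∀ {x a b} u → 2 ≤ a → b < u * u → Between x ⟦ a ⟧ ⟦ b ⟧ → Between (x ^5/2) ½ ⟦ 2 * u ^ 5 ⟧
^5/2-between {x} u 2≤a b<uu X = √-between
  (subst (Between (x ^ᴿ 5) ¼) (trans (cong ⟦_⟧ square) (sym (⟦⟧-* (2 * u ^ 5) (2 * u ^ 5))))
    (^ᴿ-between (u * u) 2≤a b<uu X 5))
  (from-yes (0ℚ ℚ.≤? ½)) (⟦⟧-< 0<2u⁵)
  (ℚ.≤-trans (from-yes (½ ℚ.≤? ⟦ 1 ⟧)) (⟦⟧-≤ 0<2u⁵))
  where
  square : 4 * (u * u) ^ 5 ≡ 2 * u ^ 5 * (2 * u ^ 5)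
  square = expanded u
    where
    expanded : ∀ u → let uu = u * u ; u⁵ = u * (u * (u * (u * (u * 1)))) in
               4 * (uu * (uu * (uu * (uu * (uu * 1))))) ≡ 2 * u⁵ * (2 * u⁵)
    expanded = solve-∀
  0<2u⁵ : 0 < 2 * u ^ 5
  0<2u⁵ = >-nonZero⁻¹ (2 * u ^ 5) {{ℕ.m*n≢0 2 (u ^ 5) {{_}} {{ℕ.m^n≢0 u 5 {{ℕ.m*n≢0⇒m≢0 u {{>-nonZero (ℕ.≤-<-trans z≤n b<uu)}}}}}}}}

recip-between : ∀ {x a b q} → Between x a b → 0ℚ ℚ.< a → 1ℚ ℚ.< q ℚ.* a → 0ℚ ℚ.≤ q →
                Between (recip x) 0ℚ q
recip-between {a = a} {b} X 0<a 1<qa 0≤q = between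
  (b , below X , subst (ℚ._< 1ℚ) (sym (ℚ.*-zeroˡ b)) (from-yes (0ℚ ℚ.<? 1ℚ)))
  (a , 0<a , above X , 1<qa) ℚ.≤-refl 0≤q

exp₂-below : ∀ {x m n} → upper x ⟦ m ⟧ → m < n → upper (exp₂ x) ⟦ 2 ^ n ⟧
exp₂-below {m = m} {n} X m<n = ⟦⟧-< (ℕ.m^n>0 2 n) , ⟦ m ⟧ , X ,
  subst₂ ℚ._<_ (sym (2^ℤ-⟦⟧ m)) (sym (ℚ.*-identityʳ ⟦ 2 ^ n ⟧)) (⟦⟧-< (ℕ.^-monoʳ-< 2 ℕ.≤-refl m<n))

fromℚ-isReal : ∀ p → IsReal (fromℚ p)
fromℚ-isReal p = record
  { lower-inhabited = p ℚ.- 1ℚ , ℚ.<-respʳ-≡ (ℚ.+-identityʳ p) (ℚ.+-monoʳ-< p (from-yes (ℚ.- 1ℚ ℚ.<? 0ℚ)))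
  ; upper-inhabited = p ℚ.+ 1ℚ , ℚ.<-respˡ-≡ (ℚ.+-identityʳ p) (ℚ.+-monoʳ-< p (from-yes (0ℚ ℚ.<? 1ℚ)))
  ; lower-closed    = ℚ.<-trans
  ; upper-closed    = λ q<q′ p<q → ℚ.<-trans p<q q<q′
  ; lower-open      = λ q<p → let m , q<m , m<p = ℚ.<-dense q<p in m , q<m , m<p
  ; upper-open      = λ p<q → let m , p<m , m<q = ℚ.<-dense p<q in m , m<q , p<m
  ; disjoint        = λ (q<p , p<q) → ℚ.<-asym q<p p<q
  ; located         = located
  }
  where
  located : ∀ {q q′} → q ℚ.< q′ → q ℚ.< p ⊎ p ℚ.< q′
  located {q} q<q′ with q ℚ.<? p
  ... | yes q<p = inj₁ q<p
  ... | no  q≮p = inj₂ (ℚ.≤-<-trans (ℚ.≮⇒≥ q≮p) q<q′)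

-- 1 / (64 * 7 ^ 5)
constant : ℚ
constant = ℤ.+ 1 ℚ./ 1075648

-- The lower bound with real exponent

module Bound {r} (S : Scales r) where

  open Scales S

  private
    -- log r < u ^ 2 and H / s = E.
    y u H E σ : ℕ
    y = s * s * (k * k)
    u = 7 * (s * k)
    H = (s * k) ^ 5
    E = y * y * k
    -- One less than `E`, since `exp₂-below` requires a strict gap.
    σ = pred E

    instance
      s≢0 : NonZero s
      s≢0 = >-nonZero (ℕ.<⇒≤ s≥2)
      k≢0 : NonZero k
      k≢0 = >-nonZero k≥1

    E≢0 : NonZero E
    E≢0 = ℕ.m*n≢0 (y * y) k {{ℕ.m*n≢0 y y {{y≢0}} {{y≢0}}}}
      where
      y≢0 : NonZero y
      y≢0 = ℕ.m*n≢0 (s * s) (k * k) {{ℕ.m*n≢0 s s}} {{ℕ.m*n≢0 k k}}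
    2≤y : 2 ≤ y
    2≤y = ℕ.≤-trans s≥2 (ℕ.≤-trans (ℕ.m≤m*n s s) (ℕ.m≤m*n (s * s) (k * k) {{ℕ.m*n≢0 k k}}))
    2≤E : 2 ≤ E
    2≤E = ℕ.≤-trans 2≤y (ℕ.≤-trans (ℕ.m≤m*n y y {{>-nonZero (ℕ.<⇒≤ 2≤y)}}) (ℕ.m≤m*n (y * y) k))
    1+σ≡E : suc σ ≡ E
    1+σ≡E = ℕ.suc-pred E {{E≢0}}

    b : ℕ
    -- One for `r < 2 ^ suc ℓ`, and two for the factor 2 and the strictness in `log₂-between`.
    b = 3 + ℓ
    b<uu : b < u * u
    b<uu = begin-strict
      3 + ℓ         <⟨ ℕ.+-monoʳ-< 3 sk-upper ⟩
      -- Rounding up to `49 * y`, a perfect square, is the source of the 7 in `u`.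
      3 + 40 * y    ≤⟨ ℕ.+-monoˡ-≤ (40 * y) (ℕ.≤-trans (ℕ.m≤m+n 3 15) (ℕ.*-monoʳ-≤ 9 2≤y)) ⟩
      9 * y + 40 * y ≡⟨ square s k ⟩
      u * u         ∎
      where
      open ℕ.≤-Reasoning
      square : ∀ s k → 9 * (s * s * (k * k)) + 40 * (s * s * (k * k)) ≡ 7 * (s * k) * (7 * (s * k))
      square = solve-∀

    A : ℕ
    -- This form lets a second `log₂-between` give the lower end `s * s` for log log r.
    A = 4 * 2 ^ (s * s)
    A+4≤ℓ : 4 + A ≤ ℓ
    A+4≤ℓ = begin
      4 + A             ≤⟨ ℕ.+-monoˡ-≤ A (ℕ.*-monoʳ-≤ 4 (ℕ.m^n>0 2 (s * s))) ⟩
      A + A             ≡⟨ ℕ.*-distribʳ-+ (2 ^ (s * s)) 4 4 ⟨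
      8 * 2 ^ (s * s)   ≤⟨ ℕ.*-monoˡ-≤ (2 ^ (s * s)) (ℕ.m≤m+n 8 8) ⟩
      16 * 2 ^ (s * s)  ≤⟨ 2^ss≤ℓ ⟩
      ℓ                 ∎
      where open ℕ.≤-Reasoning

    r-between : Between (fromℕ r) ⟦ 4 * 2 ^ A ⟧ ⟦ suc r ⟧
    r-between = fromℕ-between (begin-strict
      4 * 2 ^ A       ≡⟨ ℕ.^-distribˡ-+-* 2 2 A ⟨
      2 ^ (2 + A)     <⟨ ℕ.^-monoʳ-< 2 ℕ.≤-refl (ℕ.≤-trans (ℕ.n≤1+n _) A+4≤ℓ) ⟩
      2 ^ ℓ           ≤⟨ 2^ℓ≤r ⟩
      r               ∎) (ℕ.n<1+n r)
      where open ℕ.≤-Reasoning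

    log-between : Between (log₂ (fromℕ r)) ⟦ A ⟧ ⟦ b ⟧
    log-between = log₂-between r-between ℕ.≤-refl (begin-strict
      2 * suc r            ≤⟨ ℕ.*-monoʳ-≤ 2 r<2^1+ℓ ⟩
      2 * 2 ^ suc ℓ        <⟨ ℕ.^-monoʳ-< 2 ℕ.≤-refl (ℕ.n<1+n (2 + ℓ)) ⟩
      2 ^ b                ∎) (ℕ.≤-trans (ℕ.m≤n+m A 4) (ℕ.≤-trans A+4≤ℓ (ℕ.m≤n+m ℓ 3)))
      where open ℕ.≤-Reasoning

    s≤b : s ≤ b
    s≤b = begin
      s                 ≤⟨ ℕ.m≤m*n s s ⟩
      s * s             ≤⟨ n≤2^n (s * s) ⟩
      2 ^ (s * s)       ≤⟨ ℕ.m≤n*m (2 ^ (s * s)) 16 ⟩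
      16 * 2 ^ (s * s)  ≤⟨ 2^ss≤ℓ ⟩
      ℓ                 ≤⟨ ℕ.m≤n+m ℓ 3 ⟩
      b                 ∎
      where open ℕ.≤-Reasoning

    -- Only the lower end enters the final estimate. The upper end may be crude, but is a square so
    -- that the root has a rational bound.
    loglog-between : Between (log₂ (log₂ (fromℕ r))) ⟦ s * s ⟧ ⟦ b * b ⟧
    loglog-between = log₂-between log-between ℕ.≤-refl (begin-strict
      2 * b           ≤⟨ ℕ.*-monoʳ-≤ 2 (n≤2^n b) ⟩
      2 ^ (1 + b)
        <⟨ ℕ.^-monoʳ-< 2 ℕ.≤-refl (ℕ.≤-trans (ℕ.+-monoˡ-≤ b (ℕ.m≤m+n 2 (1 + ℓ))) (ℕ.+-monoʳ-≤ b (ℕ.m≤m+n b ((1 + ℓ) * b)))) ⟩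
      2 ^ (b * b)     ∎)
      (ℕ.*-mono-≤ s≤b s≤b)
      where open ℕ.≤-Reasoning

    0<⟦s⟧ : 0ℚ ℚ.< ⟦ s ⟧
    0<⟦s⟧ = ⟦⟧-< (>-nonZero⁻¹ s)

    1/s : ℚ
    1/s = (ℚ.1/ ⟦ s ⟧) {{ℚ.>-nonZero 0<⟦s⟧}}

    1/s-inverse : 1/s ℚ.* ⟦ s ⟧ ≡ 1ℚ
    1/s-inverse = ℚ.*-inverseˡ ⟦ s ⟧ {{ℚ.>-nonZero 0<⟦s⟧}}

    0≤1/s : 0ℚ ℚ.≤ 1/s
    0≤1/s = ℚ.<⇒≤ (ℚ.positive⁻¹ 1/s {{ℚ.1/pos⇒pos ⟦ s ⟧ {{ℚ.positive 0<⟦s⟧}}}})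

    -- The factor 2 provides the strict inequality demanded by the upper cut of `recip`.
    denominator : Between (recip (√ log₂ (log₂ (fromℕ r)))) 0ℚ (⟦ 2 ⟧ ℚ.* 1/s)
    denominator = recip-between (√-between-⟦⟧ loglog-between s≤b (s≤s z≤n)) 0<⟦s⟧
      (subst (1ℚ ℚ.<_) (sym (trans (ℚ.*-assoc ⟦ 2 ⟧ 1/s ⟦ s ⟧) (cong (⟦ 2 ⟧ ℚ.*_) 1/s-inverse)))
        (from-yes (1ℚ ℚ.<? ⟦ 2 ⟧ ℚ.* 1ℚ)))
      (*-mono-≤ ℚ.≤-refl (⟦⟧-≤ {n = 2} z≤n) ℚ.≤-refl 0≤1/s)

    ⅛ γ : ℚ
    ⅛ = ℤ.+ 1 ℚ./ 8
    -- Twice `constant`, as strict bounds are needed; `γ` times 33614 = 2 * 7 ^ 5 is 1/16, strictly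
    -- below `⅛`.
    γ = ℤ.+ 1 ℚ./ 537824

    constant-between : Between (fromℚ constant) (ℤ.+ 1 ℚ./ 2151296) γ
    constant-between = between
      (from-yes (ℤ.+ 1 ℚ./ 2151296 ℚ.<? constant)) (from-yes (constant ℚ.<? γ))
      (from-yes (0ℚ ℚ.≤? ℤ.+ 1 ℚ./ 2151296)) (from-yes (ℤ.+ 1 ℚ./ 2151296 ℚ.≤? γ))

    0<H : 0 < H
    0<H = >-nonZero⁻¹ H {{ℕ.m^n≢0 (s * k) 5 {{ℕ.m*n≢0 s k}}}}

    numerator-bound : γ ℚ.* ⟦ 2 * u ^ 5 ⟧ ℚ.< ⅛ ℚ.* ⟦ H ⟧
    numerator-bound = begin-strict
      γ ℚ.* ⟦ 2 * u ^ 5 ⟧              ≡⟨ cong (λ n → γ ℚ.* ⟦ n ⟧) (scale (s * k)) ⟩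
      γ ℚ.* ⟦ 33614 * H ⟧              ≡⟨ cong (γ ℚ.*_) (⟦⟧-* 33614 H) ⟨
      γ ℚ.* (⟦ 33614 ⟧ ℚ.* ⟦ H ⟧)      ≡⟨ ℚ.*-assoc γ ⟦ 33614 ⟧ ⟦ H ⟧ ⟨
      γ ℚ.* ⟦ 33614 ⟧ ℚ.* ⟦ H ⟧
        <⟨ ℚ.*-monoˡ-<-pos ⟦ H ⟧ {{ℚ.positive (⟦⟧-< 0<H)}} (from-yes (γ ℚ.* ⟦ 33614 ⟧ ℚ.<? ⅛)) ⟩
      ⅛ ℚ.* ⟦ H ⟧                      ∎
      where
      open ℚ.≤-Reasoning
      scale : ∀ x → let 7x = 7 * x in 2 * (7x * (7x * (7x * (7x * (7x * 1))))) ≡ 33614 * (x * (x * (x * (x * (x * 1)))))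
      scale = solve-∀

    numerator : Between (fromℚ constant *ᴿ log₂ (fromℕ r) ^5/2) 0ℚ (⅛ ℚ.* ⟦ H ⟧)
    numerator = *ᴿ-between constant-between (^5/2-between u 2≤A b<uu log-between)
      ℚ.≤-refl (from-yes (0ℚ ℚ.<? (ℤ.+ 1 ℚ./ 2151296) ℚ.* ½)) numerator-bound
      where
      2≤A : 2 ≤ A
      2≤A = ℕ.≤-trans (ℕ.m≤m+n 2 2) (ℕ.*-monoʳ-≤ 4 (ℕ.m^n>0 2 (s * s)))

    quotient-bound : ⅛ ℚ.* ⟦ H ⟧ ℚ.* (⟦ 2 ⟧ ℚ.* 1/s) ℚ.< ⟦ σ ⟧
    quotient-bound = begin-strict
      ⅛ ℚ.* ⟦ H ⟧ ℚ.* (⟦ 2 ⟧ ℚ.* 1/s)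
        ≡⟨ cong (λ n → ⅛ ℚ.* ⟦ n ⟧ ℚ.* (⟦ 2 ⟧ ℚ.* 1/s)) (factor s k) ⟩
      ⅛ ℚ.* ⟦ E * s ⟧ ℚ.* (⟦ 2 ⟧ ℚ.* 1/s)          ≡⟨ cong (λ x → ⅛ ℚ.* x ℚ.* (⟦ 2 ⟧ ℚ.* 1/s)) (⟦⟧-* E s) ⟨
      ⅛ ℚ.* (⟦ E ⟧ ℚ.* ⟦ s ⟧) ℚ.* (⟦ 2 ⟧ ℚ.* 1/s)  ≡⟨ regroup ⅛ ⟦ E ⟧ ⟦ s ⟧ ⟦ 2 ⟧ 1/s ⟩
      ⅛ ℚ.* ⟦ 2 ⟧ ℚ.* ⟦ E ⟧ ℚ.* (1/s ℚ.* ⟦ s ⟧)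
        ≡⟨ trans (cong (⅛ ℚ.* ⟦ 2 ⟧ ℚ.* ⟦ E ⟧ ℚ.*_) 1/s-inverse) (ℚ.*-identityʳ _) ⟩
      -- Since `2 ≤ E`, passing from `E` to `σ` is covered by the spare factor 4.
      ¼ ℚ.* ⟦ E ⟧                                  <⟨ ℚ.*-monoʳ-<-pos ¼ (⟦⟧-< E<4σ) ⟩
      ¼ ℚ.* ⟦ 4 * σ ⟧                              ≡⟨ cong (¼ ℚ.*_) (⟦⟧-* 4 σ) ⟨
      ¼ ℚ.* (⟦ 4 ⟧ ℚ.* ⟦ σ ⟧)                      ≡⟨ ℚ.*-assoc ¼ ⟦ 4 ⟧ ⟦ σ ⟧ ⟨
      ¼ ℚ.* ⟦ 4 ⟧ ℚ.* ⟦ σ ⟧                        ≡⟨ ℚ.*-identityˡ ⟦ σ ⟧ ⟩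
      ⟦ σ ⟧                                        ∎
      where
      open ℚ.≤-Reasoning
      factor : ∀ s k → let x = s * k in x * (x * (x * (x * (x * 1)))) ≡ s * s * (k * k) * (s * s * (k * k)) * k * s
      factor = solve-∀
      regroup : ∀ a e s t i → a ℚ.* (e ℚ.* s) ℚ.* (t ℚ.* i) ≡ a ℚ.* t ℚ.* e ℚ.* (i ℚ.* s)
      regroup = solve 5 (λ a e s t i → a :* (e :* s) :* (t :* i) := a :* t :* e :* (i :* s)) refl
        where open +-*-Solver
      E<4σ : E < 4 * σ
      E<4σ = subst (_< 4 * σ) 1+σ≡E (ℕ.≤-trans (ℕ.+-monoˡ-≤ σ (ℕ.+-mono-≤ 1≤σ 1≤σ))
        (ℕ.≤-trans (ℕ.m≤m+n (σ + σ + σ) σ) (ℕ.≤-reflexive (quadruple σ))))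
        where
        1≤σ : 1 ≤ σ
        1≤σ = s≤s⁻¹ (subst (2 ≤_) (sym 1+σ≡E) 2≤E)
        quadruple : ∀ n → n + n + n + n ≡ 4 * n
        quadruple = solve-∀

    exponent : Cut
    exponent = fromℚ constant *ᴿ (log₂ (fromℕ r) ^5/2) ÷ᴿ √ (log₂ (log₂ (fromℕ r)))

  bound : exp₂ exponent <ᴿ fromℕ (G r)
  bound = ⟦ 2 ^ E ⟧
    , exp₂-below {exponent} {σ} {E} (*ᴿ-below numerator denominator quotient-bound) (ℕ.≤-reflexive 1+σ≡E)
    , subst (⟦ 2 ^ E ⟧ ℚ.<_) (sym (/1≡⟦⟧ (G r)))
        (⟦⟧-< (grid-lower-bound r s k (ℕ.≤-trans (ℕ.^-monoʳ-≤ 2 sk-lower) 2^ℓ≤r) few))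

theorem1p2 : ∃[ c ] (IsReal c × fromℕ 0 <ᴿ c × (∃[ r₀ ] ((r : ℕ) → r₀ ≤ r →
    exp₂ (c *ᴿ (log₂ (fromℕ r) ^5/2) ÷ᴿ √ (log₂ (log₂ (fromℕ r)))) <ᴿ fromℕ (G r))))
theorem1p2 = fromℚ constant , fromℚ-isReal constant
  , (ℤ.+ 1 ℚ./ 2151296 , from-yes (0ℚ ℚ.<? ℤ.+ 1 ℚ./ 2151296) , from-yes (ℤ.+ 1 ℚ./ 2151296 ℚ.<? constant))
  , 2 ^ 256 , λ r large → Bound.bound (scales r large)
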